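{- For all integers $n \geq 2$, $\mathrm{ar}^{\star}(n, K_4^-) = \lfloor 3(n-1)/2 \rfloor$. Moreover, every star-colouring of $K_n$ that contains no rainbow copy of $K_4^-$ and uses exactly $\lfloor 3(n-1)/2\rfloor$ colours has, up to renaming the colours, the following structure. There is an ordering $v_1,\ldots,v_n$ of the vertices of $K_n$ such that the colouring is obtained by first colouring each edge $v_iv_j$ with colour $\min\{i,j\}$, and then recolouring the edges of the following graph $J$ so that all edges of each component of $J$ receive a common new colour, distinct components (with at least one edge) receiving distinct new colours: \begin{itemize} \item if $n=2m+1$ is odd, then $E(J) = \{ v_1v_2, v_3v_4,\ldots,v_{2m-1}v_{2m}\}$; \item if $n=2m\ge 4$ is even, then for some integer $a$ with $3 \leq 2a+1 \leq n-1$, $$E(J) = \{v_1v_2,v_3v_4,\ldots,v_{2a-3}v_{2a-2} \} \cup E(S) \cup \{v_{2a+2}v_{2a+3},\ldots,v_{2m-2}v_{2m-1}\},$$ where $S$ is a graph on vertex set $\{v_{2a-1},v_{2a},v_{2a+1}\}$ with one or two edges; \item if $n=2$, then $E(J)=\emptyset$. \end{itemize}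
   Context: $K_4^-$ is the graph obtained from $K_4$ by removing one edge. A star-colouring of a graph $G$ is an edge-colouring of $G$ in which every colour class is a star (a copy of $K_{1,m}$ with $m\ge 1$, a single edge being allowed). An edge-coloured graph is rainbow if all its edges have different colours. For a graph $H$, $\mathrm{ar}^{\star}(n,H)$ denotes the maximum $s\in\mathbb N$ such that there exists a star-colouring of $K_n$ using exactly $s$ colours and without a rainbow copy of $H$. In the even case, the first listed set of edges is empty if $a=1$, and the last listed set is empty if $2a+1=n-1$. -}

module Defs where

open import Data.Fin using (Fin; zero; toℕ)
open import Data.Fin.Patterns using (0F; 1F; 2F; 3F)
open import Data.Fin.Permutation using (Permutation′; _⟨$⟩ʳ_)
open import Data.Fin.Subset using (Subset; _∈_; ∣_∣)
open import Data.Nat using (ℕ; _+_; _*_; _∸_; _⊓_; _≤_)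
open import Data.Product using (_×_; _,_; ∃; ∃₂; proj₁; swap)
open import Data.Sum using (_⊎_; inj₁; inj₂; [_,_]) renaming (swap to ⊎-swap)
open import Data.Empty using (⊥)
open import Function using (_∘_)
open import Function.Bundles using (_⇔_)
open import Function.Definitions using (Injective)
open import Relation.Binary.Construct.Closure.ReflexiveTransitive using () renaming (Star to Walk)
open import Relation.Binary.PropositionalEquality using (_≡_; _≢_; refl; sym; trans)
open import Relation.Nullary using (¬_)

record Graph (n : ℕ) : Set₁ where
  field
    Adj        : Fin n → Fin n → Set
    adj-sym    : ∀ {i j} → Adj i j → Adj j i
    adj-irrefl : ∀ {i} → ¬ Adj i i

open Graph public

-- {i , j} = {k , l} as unordered pairs.
SameEdge : ∀ {n} → (i j k l : Fin n) → Set
SameEdge i j k l = (i ≡ k × j ≡ l) ⊎ (i ≡ l × j ≡ k)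

complete : ∀ n → Graph n
complete n = record
  { Adj        = _≢_
  ; adj-sym    = λ i≢j → i≢j ∘ sym
  ; adj-irrefl = λ i≢i → i≢i refl
  }

deleteEdge : ∀ {n} → Graph n → Fin n → Fin n → Graph n
deleteEdge G a b = record
  { Adj        = λ i j → Adj G i j × ¬ SameEdge i j a b
  ; adj-sym    = λ (e , ne) → adj-sym G e , ne ∘ [ inj₂ ∘ swap , inj₁ ∘ swap ]
  ; adj-irrefl = adj-irrefl G ∘ proj₁
  }

K₄⁻ : Graph 4
K₄⁻ = deleteEdge (complete 4) 2F 3F

K₁,_ : ∀ m → Graph (1 + m)
K₁, m = record
  { Adj        = λ i j → (i ≡ zero × j ≢ zero) ⊎ (i ≢ zero × j ≡ zero)
  ; adj-sym    = λ { (inj₁ (p , q)) → inj₂ (q , p) ; (inj₂ (p , q)) → inj₁ (q , p) }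
  ; adj-irrefl = λ { (inj₁ (p , q)) → q p ; (inj₂ (p , q)) → p q }
  }

-- The edges of G form a copy of H; isolated vertices of G are disregarded.
EdgesFormCopyOf : ∀ {k n} → Graph k → Graph n → Set
EdgesFormCopyOf {k} {n} H G =
  ∃ λ (f : Fin k → Fin n) → Injective _≡_ _≡_ f ×
    (∀ i j → Adj G i j ⇔ (∃₂ λ u w → Adj H u w × f u ≡ i × f w ≡ j))

IsStar : ∀ {n} → Graph n → Set
IsStar G = ∃ λ m → 1 ≤ m × EdgesFormCopyOf (K₁, m) G

-- An edge-colouring of K_n using exactly s colours.  The values on the diagonal
-- carry no meaning: every notion below looks only at pairs i ≢ j.
record Colouring (n s : ℕ) : Set where
  field
    colour     : Fin n → Fin n → Fin s
    colour-sym : ∀ i j → colour i j ≡ colour j i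
    all-used   : ∀ k → ∃₂ λ i j → i ≢ j × colour i j ≡ k

open Colouring public

colourClass : ∀ {n s} → Colouring n s → Fin s → Graph n
colourClass c k = record
  { Adj        = λ i j → i ≢ j × colour c i j ≡ k
  ; adj-sym    = λ {i} {j} (i≢j , e) → i≢j ∘ sym , trans (colour-sym c j i) e
  ; adj-irrefl = λ (i≢i , _) → i≢i refl
  }

IsStarColouring : ∀ {n s} → Colouring n s → Set
IsStarColouring c = ∀ k → IsStar (colourClass c k)

-- In K_n every injection of the vertices of H yields a copy of H.
HasRainbow : ∀ {n s k} → Graph k → Colouring n s → Set
HasRainbow {n} {s} {k} H c =
  ∃ λ (f : Fin k → Fin n) → Injective _≡_ _≡_ f ×
    (∀ u w x y → Adj H u w → Adj H x y →
      colour c (f u) (f w) ≡ colour c (f x) (f y) → SameEdge u w x y)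

GoodColouring : ∀ {n s k} → Graph k → Colouring n s → Set
GoodColouring H c = IsStarColouring c × ¬ HasRainbow H c

-- ar⋆(n , H) = s
Isar⋆ : ∀ {k} → ℕ → Graph k → ℕ → Set
Isar⋆ n H s =
  (∃ λ (c : Colouring n s) → GoodColouring H c) ×
  (∀ s′ (c : Colouring n s′) → GoodColouring H c → s′ ≤ s)

-- The choices determining J.  S is a set of edges of the triangle on
-- v_{2a-1}, v_{2a}, v_{2a+1}, numbered as in triangleEdge.
data Shape (n : ℕ) : Set where
  odd  : ∀ m → n ≡ 2 * m + 1 → Shape n
  even : ∀ m → n ≡ 2 * m → 4 ≤ n →
         ∀ a → 3 ≤ 2 * a + 1 → 2 * a + 1 ≤ n ∸ 1 →
         (S : Subset 3) → 1 ≤ ∣ S ∣ → ∣ S ∣ ≤ 2 → Shape n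
  two  : n ≡ 2 → Shape n

triangleEdge : ℕ → Fin 3 → ℕ × ℕ
triangleEdge a 0F = 2 * a ∸ 1 , 2 * a
triangleEdge a 1F = 2 * a ∸ 1 , 2 * a + 1
triangleEdge a 2F = 2 * a     , 2 * a + 1

-- Listed σ x y means that v_x v_y, written in this order with 1-based indices,
-- is one of the edges listed for J.
Listed : ∀ {n} → Shape n → ℕ → ℕ → Set
Listed (odd m _) x y =
  ∃ λ t → 1 ≤ t × t ≤ m × (x , y) ≡ (2 * t ∸ 1 , 2 * t)
Listed (even m _ _ a _ _ S _ _) x y =
  (∃ λ t → 1 ≤ t × t ≤ a ∸ 1 × (x , y) ≡ (2 * t ∸ 1 , 2 * t)) ⊎
  (∃ λ e → e ∈ S × (x , y) ≡ triangleEdge a e) ⊎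
  (∃ λ t → a + 1 ≤ t × t ≤ m ∸ 1 × (x , y) ≡ (2 * t , 2 * t + 1))
Listed (two _) x y = ⊥

-- The 1-based index of a position in the ordering.
index : ∀ {n} → Fin n → ℕ
index i = 1 + toℕ i

-- J as a graph on the positions: i stands for v_{index i}.
J : ∀ {n} → Shape n → Graph n
J σ = record
  { Adj        = λ i j → i ≢ j × (Listed σ (index i) (index j) ⊎ Listed σ (index j) (index i))
  ; adj-sym    = λ (i≢j , e) → i≢j ∘ sym , ⊎-swap e
  ; adj-irrefl = λ (i≢i , _) → i≢i refl
  }

-- The colours of the model colouring are inj₁ (min {i , j}) for the edges
-- outside J and inj₂ of a name of the component for the edges of J.  Since every
-- colour of c is used, an injective rename is a bijection onto the model's colours.
record HasStructure {n s : ℕ} (c : Colouring n s) : Set where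
  field
    ordering         : Permutation′ n
    shape            : Shape n
    component        : Fin n → ℕ
    component-spec   : ∀ i j → component i ≡ component j ⇔ Walk (Adj (J shape)) i j
    rename           : Fin s → ℕ ⊎ ℕ
    rename-injective : Injective _≡_ _≡_ rename
    outside-J        : ∀ i j → i ≢ j → ¬ Adj (J shape) i j →
                       rename (colour c (ordering ⟨$⟩ʳ i) (ordering ⟨$⟩ʳ j))
                         ≡ inj₁ (index i ⊓ index j)
    inside-J         : ∀ i j → Adj (J shape) i j →
                       rename (colour c (ordering ⟨$⟩ʳ i) (ordering ⟨$⟩ʳ j))
                         ≡ inj₂ (component i)

{-# OPTIONS --safe #-}

-- Call a colour saturated at v if all its edges contain v.  Without a rainbow K₄⁻
-- no vertex has three saturated colours, so deleting a vertex loses at most two.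
-- Suppose every vertex has two.  Then "the colour class of xv has at least two edges
-- and centre x" is a transitive relation on pairs x, v, and an undominated vertex v has
-- a partner u such that v and u send one colour each to all other vertices and uv has a
-- third colour.  Peeling off such pairs forces n to be odd and yields the ordering.
-- Hence for even n some vertex loses at most one colour, which gives the bound.  In the
-- extremal even case deleting that vertex leaves the extremal odd structure; putting it
-- back, it sinks below the pairs to which it is joined by their own colours, and the
-- first pair where this fails is completed by it to the exceptional triangle S.
module Submission where

open import Data.Bool using (Bool; true; false; T; if_then_else_)
open import Data.Bool.Properties using (T?)
open import Data.Empty using (⊥; ⊥-elim)
open import Data.Fin using (Fin; zero; suc; toℕ; punchIn; punchOut; _↑ˡ_; _↑ʳ_; _<_; splitAt; join)
open import Data.Fin.Patterns using (0F; 1F; 2F; 3F; 4F)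
import Data.Fin.Permutation as Permutation
open import Data.Fin.Properties using
  ( _≟_; _<?_; any?; all?; ¬∀⟶∃¬; <-cmp; 0≢1+n; suc-injective; injective⇒≤
  ; punchIn-injective; punchInᵢ≢i; punchIn-punchOut; toℕ<n; toℕ-injective; toℕ-↑ˡ; toℕ-↑ʳ
  ; ↑ʳ-injective; splitAt-↑ˡ; splitAt-↑ʳ; join-splitAt )
open import Data.Fin.Subset using (Subset; _∈_; ∣_∣)
open import Data.List using (List; []; _∷_; length; filter; allFin)
open import Data.List.Properties using (length-tabulate)
open import Data.List.Relation.Unary.All as All using (All; []; _∷_)
import Data.List.Relation.Unary.All.Properties as All
open import Data.List.Relation.Unary.AllPairs using ([]; _∷_)
open import Data.List.Relation.Unary.Unique.Propositional using (Unique)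
import Data.List.Relation.Unary.Unique.Propositional.Properties as Unique
open import Data.Nat as ℕ using (ℕ; zero; suc; _+_; _*_; _∸_; _/_; _⊓_; _≤_; s≤s; z≤n)
open import Data.Nat.DivMod using (+-distrib-/-∣ˡ)
open import Data.Nat.Divisibility using (divides)
open import Data.Nat.Properties as ℕ using
  ( ≤-trans; ≤-reflexive; <⇒≤; <⇒≢; 1+n≰n; n<1+n; m≤m+n; +-comm; +-suc
  ; +-monoʳ-≤; +-monoʳ-<; *-monoʳ-≤; +-cancelˡ-≤; +-cancelˡ-≡; *-suc; *-distribˡ-+
  ; ⊓-comm; m≤n⇒m⊓n≡m; +-distribˡ-⊓; module ≤-Reasoning )
open import Data.Product using (Σ; ∃; ∃₂; _×_; _,_; proj₁; proj₂)
open import Data.Sum as Sum using (_⊎_; inj₁; inj₂; [_,_]′)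
open import Data.Sum.Properties using (inj₁-injective; inj₂-injective)
open import Data.Vec using ([]; _∷_; here; there)
open import Data.Vec.Functional using () renaming (_∷_ to _∷ᶠ_; [] to []ᶠ)
open import Function using (_∘_; id)
open import Function.Bundles using (_⇔_; mk⇔; module Equivalence)
open import Function.Definitions using (Injective)
open import Relation.Binary.Construct.Closure.ReflexiveTransitive as Star using (Star; ε; _◅_; gmap; fold)
open import Relation.Binary.Definitions using (tri<; tri≈; tri>)
open import Relation.Binary.PropositionalEquality hiding (J)
open import Relation.Nullary using (¬_; Dec; yes; no; contradiction)
open import Relation.Nullary.Decidable using (_×-dec_; _⊎-dec_; _→-dec_; ¬?; decidable-stable; from-yes)
open import Relation.Unary using (Decidable)
open import Defs

-- A bare induction with two lost colours per vertex only gives 2(n-1). The true bound grows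
-- alternately by 1 and 2, so parity must enter the argument. It enters through rigidity: if every
-- vertex has two saturated colours, the colouring is determined up to names. This one fact gives
-- the bound in even order, uniqueness in odd order, and the skeleton to which the last vertex is
-- added in even order.
--
-- Deletion may empty colour classes, so star-colourings with exactly `s` colours are not closed
-- under it. The argument therefore runs on matrices satisfying four conditions on at most four
-- vertices, which every injective restriction inherits, and the palette is never renumbered.
--
-- A pair and the exceptional triangle are two instances of one kind of block: each vertex has its
-- own colour towards everything below, and one extra colour stays inside. Hence a single lemma on
-- blocks yields the names, the components and J.

private variable
  A : Set
  b k m n s : ℕ

-- Saturated colours

Matrix : ℕ → ℕ → Set
Matrix n s = Fin n → Fin n → Fin s

Rainbow△ : ∀ {n s} → Matrix n s → (a b x : Fin n) → Set
Rainbow△ c a b x = c a b ≢ c a x × c a b ≢ c b x × c a x ≢ c b x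

-- What is used of a star-colouring without rainbow K₄⁻.  Two rainbow triangles abx
-- and aby form a K₄⁻; disjoint edges have different colours, so only the two
-- coincidences in `pinched` can prevent it from being rainbow.
record Local {n s} (c : Matrix n s) : Set where
  field
    symm     : ∀ a b → c a b ≡ c b a
    disjoint : ∀ {a b x y} → a ≢ b → x ≢ y → a ≢ x → a ≢ y → b ≢ x → b ≢ y →
               c a b ≢ c x y
    no-mono△ : ∀ {a b d} → a ≢ b → a ≢ d → b ≢ d → c a b ≡ c a d → c a b ≢ c b d
    pinched  : ∀ {a b x y} → a ≢ b → a ≢ x → a ≢ y → b ≢ x → b ≢ y → x ≢ y →
               Rainbow△ c a b x → Rainbow△ c a b y → c a x ≡ c a y ⊎ c b x ≡ c b y

restrict : ∀ {n m s} → Matrix n s → (Fin m → Fin n) → Matrix m s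
restrict c g i j = c (g i) (g j)

local-restrict : ∀ {n m s} {c : Matrix n s} → Local c →
  {g : Fin m → Fin n} → Injective _≡_ _≡_ g → Local (restrict c g)
local-restrict l inj = record
  { symm     = λ a b → symm _ _
  ; disjoint = λ p q r s t u → disjoint (p ∘ inj) (q ∘ inj) (r ∘ inj) (s ∘ inj) (t ∘ inj) (u ∘ inj)
  ; no-mono△ = λ p q r → no-mono△ (p ∘ inj) (q ∘ inj) (r ∘ inj)
  ; pinched  = λ p q r s t u → pinched (p ∘ inj) (q ∘ inj) (r ∘ inj) (s ∘ inj) (t ∘ inj) (u ∘ inj)
  }
  where open Local l

-- The colour of va occurs only at v, respectively the colour class of xv has
-- at least two edges and centre x.
Saturated : ∀ {n s} → Matrix n s → Fin n → Fin n → Set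
Saturated c v a = v ≢ a × (∀ z → z ≢ v → z ≢ a → c a z ≢ c a v)

Dominates : ∀ {n s} → Matrix n s → Fin n → Fin n → Set
Dominates c x v = x ≢ v × ∃ λ z → z ≢ v × z ≢ x × c x z ≡ c x v

TwoSaturated : ∀ {n s} → Matrix n s → Fin n → Set
TwoSaturated c v = ∃₂ λ a b → Saturated c v a × Saturated c v b × c v a ≢ c v b

UniformPair : ∀ {n s} → Matrix n s → Fin n → Fin n → Set
UniformPair c v u = ∀ x y → v ≢ x → u ≢ x → v ≢ y → u ≢ y →
  c v x ≡ c v y × c u x ≡ c u y × c v x ≢ c u x × c v x ≢ c v u × c u x ≢ c v u

module _ {n s : ℕ} (c : Matrix n s) where

  dominates? : ∀ x v → Dec (Dominates c x v)
  dominates? x v = ¬? (x ≟ v) ×-dec any? (λ z → ¬? (z ≟ v) ×-dec ¬? (z ≟ x) ×-dec (c x z ≟ c x v))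

  saturated-or-dominates : ∀ {v x} → v ≢ x → Saturated c v x ⊎ Dominates c x v
  saturated-or-dominates {v} {x} v≢x with dominates? x v
  ... | yes d = inj₂ d
  ... | no ¬d = inj₁ (v≢x , λ z z≢v z≢x e → ¬d (v≢x ∘ sym , z , z≢v , z≢x , e))

  saturated⇒¬dominates : ∀ {v x} → Saturated c v x → ¬ Dominates c x v
  saturated⇒¬dominates (_ , s) (_ , z , z≢v , z≢x , e) = s z z≢v z≢x e

  saturated? : ∀ v x → Dec (Saturated c v x)
  saturated? v x with v ≟ x
  ... | yes v≡x = no λ s → proj₁ s v≡x
  ... | no v≢x with saturated-or-dominates v≢x
  ...   | inj₁ s = yes s
  ...   | inj₂ d = no λ s → saturated⇒¬dominates s d

  twoSaturated? : ∀ v → Dec (TwoSaturated c v)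
  twoSaturated? v = any? λ a → any? λ b →
    saturated? v a ×-dec saturated? v b ×-dec ¬? (c v a ≟ c v b)

module LocalTheory {n s : ℕ} {c : Matrix n s} (l : Local c) where
  open Local l

  flip≡ : ∀ {a b x y} → c a b ≡ c x y → c b a ≡ c y x
  flip≡ {a} {b} {x} {y} e = trans (symm b a) (trans e (symm x y))

  flipˡ : ∀ {a b k} → c a b ≡ k → c b a ≡ k
  flipˡ {a} {b} = trans (symm b a)

  -- The class of `ax` has centre `a`: another edge of this colour at `x` would close a
  -- monochromatic triangle if it ended in `b`, and would be disjoint from `ab` otherwise.
  same-colour⇒saturated : ∀ {a x b} → a ≢ x → a ≢ b → x ≢ b → c a x ≡ c a b → Saturated c a x
  same-colour⇒saturated {a} {x} {b} a≢x a≢b x≢b e = a≢x , sat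
    where
    sat : ∀ z → z ≢ a → z ≢ x → c x z ≢ c x a
    sat z z≢a z≢x f with z ≟ b
    ... | yes refl = no-mono△ a≢x a≢b x≢b e (trans (symm a x) (sym f))
    ... | no z≢b   = disjoint (z≢x ∘ sym) a≢b (a≢x ∘ sym) x≢b z≢a z≢b (trans f (trans (symm x a) e))

  dominates⇒saturated : ∀ {x v} → Dominates c x v → Saturated c x v
  dominates⇒saturated (x≢v , z , z≢v , z≢x , e) =
    same-colour⇒saturated x≢v (z≢x ∘ sym) (z≢v ∘ sym) (sym e)

  saturated-rainbow : ∀ {v a b} → Saturated c v a → Saturated c v b → c v a ≢ c v b →
    Rainbow△ c v a b
  saturated-rainbow {v} {a} {b} (v≢a , sa) (v≢b , sb) va≢vb =
    va≢vb ,
    (λ e → sa b (v≢b ∘ sym) b≢a (trans (sym e) (symm v a))) ,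
    (λ e → sb a (v≢a ∘ sym) (b≢a ∘ sym) (trans (symm b a) (trans (sym e) (symm v b))))
    where
    b≢a : b ≢ a
    b≢a refl = va≢vb refl

  -- Any two of `x`, `y`, `z` span a rainbow triangle with `v`. Pinching the triangles on `vx` gives
  -- `xy` and `xz` one colour, pinching those on `vy` extends it to `yz`, and `xyz` is
  -- monochromatic.
  no-three-saturated : ∀ {v x y z} → Saturated c v x → Saturated c v y → Saturated c v z →
    c v x ≢ c v y → c v x ≢ c v z → c v y ≢ c v z → ⊥
  no-three-saturated {v} {x} {y} {z} sx sy sz x≁y x≁z y≁z
    with pinched (proj₁ sx) (proj₁ sy) (proj₁ sz) x≢y x≢z y≢z
           (saturated-rainbow sx sy x≁y) (saturated-rainbow sx sz x≁z)
       | pinched (proj₁ sy) (proj₁ sx) (proj₁ sz) (x≢y ∘ sym) y≢z x≢z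
           (saturated-rainbow sy sx (x≁y ∘ sym)) (saturated-rainbow sy sz y≁z)
    where
    x≢y : x ≢ y
    x≢y refl = x≁y refl
    x≢z : x ≢ z
    x≢z refl = x≁z refl
    y≢z : y ≢ z
    y≢z refl = y≁z refl
  ... | inj₁ e | _      = y≁z e
  ... | inj₂ _ | inj₁ e = x≁z e
  ... | inj₂ e | inj₂ f =
    no-mono△ (λ { refl → x≁y refl }) (λ { refl → x≁z refl }) (λ { refl → y≁z refl })
      e (trans (symm x y) f)

  saturated-dominator-≢ : ∀ {v a x} → Saturated c v a → Dominates c x v → x ≢ a
  saturated-dominator-≢ s d refl = saturated⇒¬dominates c s d

  -- The class of `xv` has centre `x`, which the edge `vb` misses.
  dominator-colour-≢ : ∀ {v b x} → Saturated c v b → Dominates c x v → c v x ≢ c v b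
  dominator-colour-≢ {v} {b} {x} sb d@(x≢v , z , z≢v , z≢x , xz) e with z ≟ b
  ... | yes refl = proj₂ sb x x≢v (saturated-dominator-≢ sb d)
                     (flip≡ (trans xz (trans (symm x v) e)))
  ... | no z≢b   = disjoint (z≢x ∘ sym) (proj₁ sb) x≢v (saturated-dominator-≢ sb d) z≢v z≢b
                     (trans xz (trans (symm x v) e))

  -- The triangle `vba` is rainbow, and so is `vbx` unless `xv` and `xb` agree. If both are rainbow,
  -- the pinch on `vb` must occur at `b`, because `vx` and `va` differ.
  dominator-dichotomy : ∀ {v a b x} → Saturated c v a → Saturated c v b → c v a ≢ c v b →
    Dominates c x v → c x v ≡ c x b ⊎ c b x ≡ c b a
  dominator-dichotomy {v} {a} {b} {x} sa sb va≢vb d with c x v ≟ c x b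
  ... | yes e = inj₁ e
  ... | no ne
    with pinched (proj₁ sb) (proj₁ d ∘ sym) (proj₁ sa)
           (saturated-dominator-≢ sb d ∘ sym) (λ { refl → va≢vb refl })
           (saturated-dominator-≢ sa d)
           (dominator-colour-≢ sb d ∘ sym ,
            (λ e → proj₂ sb x (proj₁ d) (saturated-dominator-≢ sb d) (trans (sym e) (symm v b))) ,
            (λ e → ne (flip≡ e)))
           (saturated-rainbow sb sa (va≢vb ∘ sym))
  ...   | inj₁ e = contradiction e (dominator-colour-≢ sa d)
  ...   | inj₂ e = inj₂ e

  another-saturated : ∀ {v} (k : Fin s) → TwoSaturated c v → ∃ λ b → Saturated c v b × c v b ≢ k
  another-saturated {v} k (a , b , sa , sb , ne) with c v a ≟ k
  ... | yes e = b , sb , λ f → ne (trans e (sym f))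
  ... | no ¬e = a , sa , ¬e

  module AllTwo (two-sat : ∀ v → TwoSaturated c v) where

    -- Here `x` is the centre of a class through `v` and `b`, and `a` of one through `x` and `b`:
    -- the mixed outcome of `dominator-dichotomy` applied with `a` and `b` in both orders. It is
    -- refuted by a second saturated colour at another vertex than `v`.
    not-twisted : ∀ {v a b x} → Saturated c v a → Saturated c v b → c v a ≢ c v b →
      Dominates c x v → c x v ≡ c x b → c a x ≡ c a b → ⊥
    not-twisted {v} {a} {b} {x} sa sb va≢vb d xv≡xb ax≡ab = by-cases (saturated-or-dominates c (proj₁ sa ∘ sym))
      where
      x≢a : x ≢ a
      x≢a = saturated-dominator-≢ sa d
      x≢b : x ≢ b
      x≢b = saturated-dominator-≢ sb d
      a≢b : a ≢ b
      a≢b refl = va≢vb refl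
      by-cases : Saturated c a v ⊎ Dominates c v a → ⊥
      -- At `a`, the saturated edges `aq` and `ab` are tested against the dominator `v`; the
      -- outcomes contradict `va≢vb` and the saturation of `vb`.
      by-cases (inj₂ dv)
        with q , sq , q≁x ← another-saturated (c a b) (two-sat a)
        with dominator-dichotomy sq (same-colour⇒saturated a≢b (x≢a ∘ sym) (x≢b ∘ sym) (sym ax≡ab)) q≁x dv
      ... | inj₁ e = va≢vb e
      ... | inj₂ e = proj₂ sb q (saturated-dominator-≢ sq dv ∘ sym) (λ { refl → q≁x refl }) (sym e)
      -- Now `va` is alone in its class. At `x`, the saturated edges `xr` and `xv` are tested
      -- against the dominator `a`; the outcomes contradict the saturation of `va` at `v` and at
      -- `a`.
      by-cases (inj₁ (_ , sv))
        with r , sr , r≁v ← another-saturated (c x v) (two-sat x)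
        with da ← (x≢a ∘ sym , b , x≢b ∘ sym , a≢b ∘ sym , sym ax≡ab)
        with dominator-dichotomy sr (same-colour⇒saturated (proj₁ d) x≢b (proj₁ sb) xv≡xb) r≁v da
      ... | inj₁ e = proj₂ sa b (proj₁ sb ∘ sym) (a≢b ∘ sym) (trans (sym ax≡ab) e)
      ... | inj₂ e = sv r (saturated-dominator-≢ sr da ∘ sym) (λ { refl → r≁v refl }) (sym e)

    -- Applied in both orders, the dichotomy leaves besides the claim only the twisted configuration
    -- and a monochromatic triangle `abx`.
    dominator-uniform : ∀ {v a x} → Dominates c x v → Saturated c v a → c x a ≡ c x v
    dominator-uniform {v} {a} {x} d sa
      with b , sb , b≁a ← another-saturated (c v a) (two-sat v)
      with dominator-dichotomy sb sa b≁a d | dominator-dichotomy sa sb (b≁a ∘ sym) d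
    ... | inj₁ e | _      = sym e
    ... | inj₂ e | inj₁ f = ⊥-elim (not-twisted sa sb (b≁a ∘ sym) d f e)
    ... | inj₂ e | inj₂ f = ⊥-elim (no-mono△ (λ { refl → b≁a refl }) (saturated-dominator-≢ sb d ∘ sym)
                              (saturated-dominator-≢ sa d ∘ sym) (sym f) (trans (symm b a) (sym e)))

    -- Since `v` dominates `w`, the edge `vw` is saturated at `v`, so uniformity puts `xw` into the
    -- class of `xv`.
    dominates-trans : ∀ {x v w} → Dominates c x v → Dominates c v w → Dominates c x w
    dominates-trans {x} {v} {w} d e = x≢w , v , proj₁ e , proj₁ d ∘ sym , sym (dominator-uniform d (dominates⇒saturated e))
      where
      x≢w : x ≢ w
      x≢w refl = saturated⇒¬dominates c (dominates⇒saturated e) d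

    -- A maximal element of a transitive irreflexive relation: a new vertex replaces the candidate
    -- only when it dominates it, and then whatever dominates the new one would dominate the old
    -- one.
    undominated : ∀ m (h : Fin (suc m) → Fin n) → ∃ λ v → ∀ j → ¬ Dominates c (h j) v
    undominated zero h = h zero , λ { zero d → proj₁ d refl }
    undominated (suc m) h with undominated m (h ∘ suc)
    ... | v , top with dominates? c (h zero) v
    ...   | no ¬d = v , λ { zero → ¬d ; (suc j) → top j }
    ...   | yes d = h zero , λ { zero e → proj₁ e refl ; (suc j) e → top j (dominates-trans e d) }

    module Peel {v : Fin n} (top : ∀ x → v ≢ x → Saturated c v x) where

      -- Two further colours at `v` besides that of `vu` would make three saturated ones. At `u` all
      -- edges are saturated too: an `x` dominating `u` would by uniformity give `xv` the colour of
      -- `xu`, against the saturation of `vx` at `v`.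
      lonely-partner : ∀ {u} → v ≢ u → (∀ x → v ≢ x → u ≢ x → c v x ≢ c v u) → UniformPair c v u
      lonely-partner {u} v≢u lonely x y v≢x u≢x v≢y u≢y =
        decidable-stable (c v x ≟ c v y) (λ ne →
          no-three-saturated (top u v≢u) (top x v≢x) (top y v≢y)
            (lonely x v≢x u≢x ∘ sym) (lonely y v≢y u≢y ∘ sym) ne) ,
        decidable-stable (c u x ≟ c u y) (λ ne →
          no-three-saturated su (satu x v≢x u≢x) (satu y v≢y u≢y) (uv≢ux x v≢x u≢x) (uv≢ux y v≢y u≢y) ne) ,
        (λ e → proj₂ (top x v≢x) u (v≢u ∘ sym) u≢x (sym (flip≡ e))) ,
        lonely x v≢x u≢x ,
        (λ e → uv≢ux x v≢x u≢x (trans (symm u v) (sym e)))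
        where
        su : Saturated c u v
        su = v≢u ∘ sym , λ z z≢u z≢v → lonely z (z≢v ∘ sym) (z≢u ∘ sym)
        uv≢ux : ∀ x → v ≢ x → u ≢ x → c u v ≢ c u x
        uv≢ux x v≢x u≢x e = proj₂ (top u v≢u) x (v≢x ∘ sym) (u≢x ∘ sym) (sym e)
        satu : ∀ x → v ≢ x → u ≢ x → Saturated c u x
        satu x v≢x u≢x with saturated-or-dominates c u≢x
        ... | inj₁ s = s
        ... | inj₂ d = ⊥-elim (proj₂ (top x v≢x) u (v≢u ∘ sym) u≢x (sym (dominator-uniform d su)))

      -- The repeated colours make `v` dominate both `a` and `b`. The edge `ab` is saturated at one
      -- of its ends, and uniformity there equates `va` and `vb`.
      not-both-plural : ∀ {a a′ b b′} → v ≢ a → v ≢ a′ → a ≢ a′ → c v a ≡ c v a′ →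
        v ≢ b → v ≢ b′ → b ≢ b′ → c v b ≡ c v b′ → c v a ≡ c v b
      not-both-plural {a} {a′} {b} {b′} v≢a v≢a′ a≢a′ ea v≢b v≢b′ b≢b′ eb with a ≟ b
      ... | yes refl = refl
      ... | no a≢b with saturated-or-dominates c a≢b
      ...   | inj₁ sb = sym (dominator-uniform (v≢a , a′ , a≢a′ ∘ sym , v≢a′ ∘ sym , sym ea) sb)
      ...   | inj₂ d  = dominator-uniform (v≢b , b′ , b≢b′ ∘ sym , v≢b′ ∘ sym , sym eb) (dominates⇒saturated d)

      partner : ∃ λ u → v ≢ u × (∀ x → v ≢ x → u ≢ x → c v x ≢ c v u)
      partner with two-sat v
      ... | p , q , (v≢p , _) , (v≢q , _) , p≁q
        with any? (λ x → ¬? (v ≟ x) ×-dec ¬? (p ≟ x) ×-dec (c v x ≟ c v p))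
           | any? (λ x → ¬? (v ≟ x) ×-dec ¬? (q ≟ x) ×-dec (c v x ≟ c v q))
      ... | no ¬e | _ = p , v≢p , λ x v≢x p≢x e → ¬e (x , v≢x , p≢x , e)
      ... | _ | no ¬e = q , v≢q , λ x v≢x p≢x e → ¬e (x , v≢x , p≢x , e)
      ... | yes (x , v≢x , p≢x , e) | yes (y , v≢y , q≢y , f) =
        contradiction (not-both-plural v≢p v≢x p≢x (sym e) v≢q v≢y q≢y (sym f)) p≁q

    undominated⇒saturated : ∀ {v} → (∀ x → ¬ Dominates c x v) → ∀ x → v ≢ x → Saturated c v x
    undominated⇒saturated undom x v≢x with saturated-or-dominates c v≢x
    ... | inj₁ s = s
    ... | inj₂ d = ⊥-elim (undom x d)

    uniform-pair : ∀ {m} → n ≡ suc m → ∃₂ λ v u → v ≢ u × UniformPair c v u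
    uniform-pair {m} refl
      with v , undom ← undominated m id
      with u , v≢u , lonely ← Peel.partner (undominated⇒saturated undom)
      = v , u , v≢u , Peel.lonely-partner (undominated⇒saturated undom) v≢u lonely

-- Odd order: peeling off pairs

data Odd : ℕ → Set where
  one  : Odd 1
  step : ∀ {n} → Odd n → Odd (2 + n)

-- The first b positions of the ordering.  Edges leaving the block at i have colour
-- γ i, and so do the edges ij inside with i < j, unless inJ gives them the colour δ.
record IsBlock {n s} b (inJ : Fin b → Fin b → Bool) (d : Matrix (b + n) s) : Set where
  field
    γ           : Fin b → Fin s
    γ-injective : Injective _≡_ _≡_ γ
    δ           : Fin s
    γ≢δ         : ∀ i → γ i ≢ δ
    cross       : ∀ i j → d (i ↑ˡ n) (b ↑ʳ j) ≡ γ i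
    inner       : ∀ i j → i < j → d (i ↑ˡ n) (j ↑ˡ n) ≡ (if inJ i j then δ else γ i)
    δ-fresh     : ∀ i j → i ≢ j → d (b ↑ʳ i) (b ↑ʳ j) ≢ δ

dropBlock : ∀ {n s} b → Matrix (b + n) s → Matrix n s
dropBlock b d = restrict d (b ↑ʳ_)

-- Entries are read only at increasing positions, so the constant function describes the single
-- edge.
pairEdges : Fin 2 → Fin 2 → Bool
pairEdges _ _ = true

data OddTower {s} : ∀ {n} → Odd n → Matrix n s → Set where
  single : ∀ {d : Matrix 1 s} → OddTower one d
  pair   : ∀ {n} {o : Odd n} {d : Matrix (2 + n) s} →
           IsBlock 2 pairEdges d → OddTower o (dropBlock 2 d) → OddTower (step o) d

∷-avoids : {x u : A} {h : Fin n → A} → x ≢ u → (∀ i → x ≢ h i) → ∀ i → x ≢ (u ∷ᶠ h) i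
∷-avoids x≢u x≢h zero    = x≢u
∷-avoids x≢u x≢h (suc i) = x≢h i

∷-injective : {u : A} {h : Fin n → A} → (∀ i → u ≢ h i) → Injective _≡_ _≡_ h →
  Injective _≡_ _≡_ (u ∷ᶠ h)
∷-injective u≢h inj {zero}  {zero}  e = refl
∷-injective u≢h inj {zero}  {suc j} e = ⊥-elim (u≢h j e)
∷-injective u≢h inj {suc i} {zero}  e = ⊥-elim (u≢h i (sym e))
∷-injective u≢h inj {suc i} {suc j} e = cong suc (inj e)

pair-injective : {x y : A} → x ≢ y → Injective _≡_ _≡_ (x ∷ᶠ y ∷ᶠ []ᶠ)
pair-injective x≢y {0F} {0F} e = refl
pair-injective x≢y {0F} {1F} e = ⊥-elim (x≢y e)
pair-injective x≢y {1F} {0F} e = ⊥-elim (x≢y (sym e))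
pair-injective x≢y {1F} {1F} e = refl

module _ {u v : Fin (2 + n)} (v≢u : v ≢ u) where

  skip : Fin n → Fin (2 + n)
  skip = punchIn v ∘ punchIn (punchOut v≢u)

  skip-injective : Injective _≡_ _≡_ skip
  skip-injective e = punchIn-injective _ _ _ (punchIn-injective v _ _ e)

  skip-≢ˡ : ∀ i → v ≢ skip i
  skip-≢ˡ i e = punchInᵢ≢i v _ (sym e)

  skip-≢ʳ : ∀ i → u ≢ skip i
  skip-≢ʳ i e = punchInᵢ≢i (punchOut v≢u) i
    (punchIn-injective v _ _ (trans (sym e) (sym (punchIn-punchOut v≢u))))

  skip-onto : ∀ x → v ≢ x → u ≢ x → ∃ λ i → skip i ≡ x
  skip-onto x v≢x u≢x = punchOut w≢y , trans (cong (punchIn v) (punchIn-punchOut w≢y)) (punchIn-punchOut v≢x)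
    where
    w≢y : punchOut v≢u ≢ punchOut v≢x
    w≢y e = u≢x (trans (sym (punchIn-punchOut v≢u)) (trans (cong (punchIn v) e) (punchIn-punchOut v≢x)))

saturated-restrict : {c : Matrix n s} {g : Fin m → Fin n} → Injective _≡_ _≡_ g → ∀ {x a} →
  Saturated c (g x) (g a) → Saturated (restrict c g) x a
saturated-restrict inj (x≢a , s) = x≢a ∘ cong _ , λ z z≢x z≢a → s _ (z≢x ∘ inj) (z≢a ∘ inj)

¬twoSaturated-on-two : (c : Matrix 2 s) → ¬ TwoSaturated c zero
¬twoSaturated-on-two c (0F , b , sa , sb , ne) = proj₁ sa refl
¬twoSaturated-on-two c (1F , 0F , sa , sb , ne) = proj₁ sb refl
¬twoSaturated-on-two c (1F , 1F , sa , sb , ne) = ne refl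

another : (x : Fin (2 + n)) → ∃ λ y → x ≢ y
another x = punchIn x zero , λ e → punchInᵢ≢i x zero (sym e)

point : ∀ {n} → Odd n → Fin n
point one      = zero
point (step _) = zero

module UniformPairs {c : Matrix (2 + n) s} (l : Local c) {u v : Fin (2 + n)} (v≢u : v ≢ u)
  (uni : UniformPair c v u) where
  open Local l
  open LocalTheory l

  -- Neither edge from the pair to `x` is saturated at `x`, because `v` and `u` send the same
  -- colours to `y`. So removing the pair costs no remaining vertex its saturated colours.
  saturated-inside : ∀ {x y a} → x ≢ y → Saturated c (skip v≢u x) a → ∃ λ i → skip v≢u i ≡ a
  saturated-inside {x} {y} {a} x≢y (_ , s) = skip-onto v≢u a v≢a u≢a
    where
    y≢x : skip v≢u y ≢ skip v≢u x
    y≢x e = x≢y (sym (skip-injective v≢u e))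
    unif = uni (skip v≢u y) (skip v≢u x) (skip-≢ˡ v≢u y) (skip-≢ʳ v≢u y) (skip-≢ˡ v≢u x) (skip-≢ʳ v≢u x)
    v≢a : v ≢ a
    v≢a refl = s _ y≢x (skip-≢ˡ v≢u y ∘ sym) (proj₁ unif)
    u≢a : u ≢ a
    u≢a refl = s _ y≢x (skip-≢ʳ v≢u y ∘ sym) (proj₁ (proj₂ unif))

  twoSaturated-rest : (∀ x → TwoSaturated c x) → (∀ x → ∃ λ y → x ≢ y) →
    ∀ x → TwoSaturated (restrict c (skip v≢u)) x
  twoSaturated-rest two-sat other x
    with a , b , sa , sb , ne ← two-sat (skip v≢u x)
    with a′ , refl ← saturated-inside (proj₂ (other x)) sa | b′ , refl ← saturated-inside (proj₂ (other x)) sb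
    = a′ , b′ , saturated-restrict {c = c} (skip-injective v≢u) sa , saturated-restrict {c = c} (skip-injective v≢u) sb , ne

  pair-block : ∀ {k} → Fin k → {h : Fin k → Fin (2 + n)} → Injective _≡_ _≡_ h →
    (∀ i → v ≢ h i) → (∀ i → u ≢ h i) → IsBlock 2 pairEdges (restrict c (v ∷ᶠ u ∷ᶠ h))
  pair-block z {h} h-inj v≢h u≢h = record
    { γ           = c v (h z) ∷ᶠ c u (h z) ∷ᶠ []ᶠ
    ; γ-injective = pair-injective (proj₁ (proj₂ (proj₂ (unif z))))
    ; δ           = c v u
    ; γ≢δ         = λ { 0F → proj₁ (proj₂ (proj₂ (proj₂ (unif z)))) ; 1F → proj₂ (proj₂ (proj₂ (proj₂ (unif z)))) }
    ; cross       = λ { 0F j → proj₁ (unif j) ; 1F j → proj₁ (proj₂ (unif j)) }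
    ; inner       = λ { 0F 1F _ → refl ; 1F 1F (s≤s ()) }
    ; δ-fresh     = λ i j i≢j → disjoint (i≢j ∘ h-inj) v≢u (v≢h i ∘ sym) (u≢h i ∘ sym) (v≢h j ∘ sym) (u≢h j ∘ sym)
    }
    where
    unif = λ j → uni (h j) (h z) (v≢h j) (u≢h j) (v≢h z) (u≢h z)

-- A single remaining vertex has no saturated colour, so the invariant of the peeling has to be a
-- disjunction.
trivial-or-plural : ∀ m {P : Fin (suc m) → Set} → ((∀ (x : Fin (suc m)) → ∃ λ y → x ≢ y) → ∀ x → P x) →
  m ≡ 0 ⊎ (∀ x → P x)
trivial-or-plural zero    _ = inj₁ refl
trivial-or-plural (suc m) f = inj₂ (f another)

OddOrdering : Matrix (suc n) s → Set
OddOrdering {n} c = Σ (Odd (suc n)) λ o → ∃ λ (g : Fin (suc n) → Fin (suc n)) →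
  Injective _≡_ _≡_ g × OddTower o (restrict c g)

prepend-pair : {c : Matrix (3 + n) s} → Local c → ∀ {u v} (v≢u : v ≢ u) → UniformPair c v u →
  OddOrdering (restrict c (skip v≢u)) → OddOrdering c
prepend-pair l {u} {v} v≢u uni (o , g , g-inj , t) =
  step o , v ∷ᶠ u ∷ᶠ (skip v≢u ∘ g) ,
  ∷-injective (∷-avoids v≢u v∉) (∷-injective u∉ inj) ,
  pair (UniformPairs.pair-block l v≢u uni zero inj v∉ u∉) t
  where
  v∉ = λ i → skip-≢ˡ v≢u (g i)
  u∉ = λ i → skip-≢ʳ v≢u (g i)
  inj : Injective _≡_ _≡_ (skip v≢u ∘ g)
  inj e = g-inj (skip-injective v≢u e)

-- Parity is a conclusion here: the peeling cannot end in two vertices, where only one edge, hence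
-- one saturated colour, is left.
odd-tower : ∀ n (c : Matrix (suc n) s) → Local c → n ≡ 0 ⊎ (∀ v → TwoSaturated c v) → OddOrdering c
odd-tower zero c l _ = one , id , id , single
odd-tower (suc zero) c l (inj₂ two-sat) = ⊥-elim (¬twoSaturated-on-two c (two-sat zero))
odd-tower (suc (suc m)) c l (inj₂ two-sat) =
  let v , u , v≢u , uni = LocalTheory.AllTwo.uniform-pair l two-sat refl
  in prepend-pair l v≢u uni (odd-tower m (restrict c (skip v≢u)) (local-restrict l (skip-injective v≢u))
       (trivial-or-plural m (UniformPairs.twoSaturated-rest l v≢u uni two-sat)))

-- Even order: putting one vertex back

-- The edge sets S that occur; the two remaining paths on three vertices only
-- reorder the path with centre 0.
data Triple : Set where
  ⟨01⟩ ⟨02⟩ ⟨12⟩ ⟨01,02⟩ : Triple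

tripleEdges : Triple → Fin 3 → Fin 3 → Bool
tripleEdges ⟨01⟩    0F 1F = true
tripleEdges ⟨02⟩    0F 2F = true
tripleEdges ⟨12⟩    1F 2F = true
tripleEdges ⟨01,02⟩ 0F 1F = true
tripleEdges ⟨01,02⟩ 0F 2F = true
tripleEdges _       _  _  = false

data EvenTower {s} : ∀ {n} → Matrix n s → Set where
  triple : ∀ {n} {o : Odd n} {d : Matrix (3 + n) s} (t : Triple) →
           IsBlock 3 (tripleEdges t) d → OddTower o (dropBlock 3 d) → EvenTower d
  pair   : ∀ {n} {d : Matrix (2 + n) s} →
           IsBlock 2 pairEdges d → EvenTower (dropBlock 2 d) → EvenTower d

-- Both families have the same index set, so for an injective `vertices` the inclusion `within`
-- already makes it a rearrangement of `f`.
record Extension (c : Matrix n s) (f : Fin m → Fin n) : Set where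
  field
    vertices  : Fin m → Fin n
    injective : Injective _≡_ _≡_ vertices
    within    : ∀ i → ∃ λ j → vertices i ≡ f j
    tower     : EvenTower (restrict c vertices)

-- A pair x, y on top of B, and a further vertex v.
record Frame (c : Matrix n s) (x y v : Fin n) (B : Fin k → Fin n) : Set where
  field
    x≢y   : x ≢ y
    x≢v   : x ≢ v
    y≢v   : y ≢ v
    x∉B   : ∀ i → x ≢ B i
    y∉B   : ∀ i → y ≢ B i
    v∉B   : ∀ i → v ≢ B i
    B-inj : Injective _≡_ _≡_ B
    X Y D O : Fin s
    X≢Y   : X ≢ Y
    X≢D   : X ≢ D
    Y≢D   : Y ≢ D
    X≢O   : X ≢ O
    Y≢O   : Y ≢ O
    D≢O   : D ≢ O
    xB    : ∀ i → c x (B i) ≡ X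
    yB    : ∀ i → c y (B i) ≡ Y
    xy    : c x y ≡ D
    xv    : c x v ≡ X ⊎ c x v ≡ D ⊎ c x v ≡ O
    yv    : c y v ≡ Y ⊎ c y v ≡ D ⊎ c y v ≡ O

module FrameTheory {n s k : ℕ} {c : Matrix n s} (l : Local c) {B : Fin k → Fin n} where
  open Local l
  open LocalTheory l

  flip-frame : ∀ {x y v} → Frame c x y v B → Frame c y x v B
  flip-frame f = record
    { x≢y = x≢y ∘ sym ; x≢v = y≢v ; y≢v = x≢v ; x∉B = y∉B ; y∉B = x∉B ; v∉B = v∉B ; B-inj = B-inj
    ; X = Y ; Y = X ; D = D ; O = O ; X≢Y = X≢Y ∘ sym ; X≢D = Y≢D ; Y≢D = X≢D ; X≢O = Y≢O ; Y≢O = X≢O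
    ; D≢O = D≢O ; xB = yB ; yB = xB ; xy = flipˡ xy ; xv = yv ; yv = xv }
    where open Frame f

  -- Each of `v`, `x`, `y` sends one colour to `B`, so only their order and the edges of colour `D`
  -- are open. An edge carrying the colour that one end sends down puts that end first; edges of
  -- colour `D` form S. If both `xv` and `yv` had colour `D`, the triangle would be monochromatic;
  -- the other eight cases fit one of the four triples.
  triple-extension : ∀ {x y v} (f : Frame c x y v B) {o : Odd k} → OddTower o (restrict c B) →
    (∀ i → c v (B i) ≡ Frame.O f) → Extension c (v ∷ᶠ x ∷ᶠ y ∷ᶠ B)
  triple-extension {x} {y} {v} f tower vB = by-cases xv yv
    where
    open Frame f

    assemble : ∀ t {a b e α β ζ} → a ≢ b → a ≢ e → b ≢ e →
      (∀ i → a ≢ B i) → (∀ i → b ≢ B i) → (∀ i → e ≢ B i) →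
      α ≢ β → α ≢ ζ → β ≢ ζ → α ≢ D → β ≢ D → ζ ≢ D →
      (∀ i → c a (B i) ≡ α) → (∀ i → c b (B i) ≡ β) → (∀ i → c e (B i) ≡ ζ) →
      c a b ≡ (if tripleEdges t 0F 1F then D else α) →
      c a e ≡ (if tripleEdges t 0F 2F then D else α) →
      c b e ≡ (if tripleEdges t 1F 2F then D else β) →
      (∀ i → ∃ λ j → (a ∷ᶠ b ∷ᶠ e ∷ᶠ []ᶠ) i ≡ (v ∷ᶠ x ∷ᶠ y ∷ᶠ []ᶠ) j) →
      Extension c (v ∷ᶠ x ∷ᶠ y ∷ᶠ B)
    assemble t {a} {b} {e} {α} {β} {ζ} a≢b a≢e b≢e a∉B b∉B e∉B α≢β α≢ζ β≢ζ α≢D β≢D ζ≢D aB bB eB ab ae be out = record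
      { vertices  = a ∷ᶠ b ∷ᶠ e ∷ᶠ B
      ; injective = ∷-injective (∷-avoids a≢b (∷-avoids a≢e a∉B))
                      (∷-injective (∷-avoids b≢e b∉B) (∷-injective e∉B B-inj))
      ; within    = members
      ; tower     = triple t (record
        { γ           = α ∷ᶠ β ∷ᶠ ζ ∷ᶠ []ᶠ
        ; γ-injective = ∷-injective (λ { 0F → α≢β ; 1F → α≢ζ }) (pair-injective β≢ζ)
        ; δ           = D
        ; γ≢δ         = λ { 0F → α≢D ; 1F → β≢D ; 2F → ζ≢D }
        ; cross       = λ { 0F → aB ; 1F → bB ; 2F → eB }
        ; inner       = λ { 0F 1F _ → ab ; 0F 2F _ → ae ; 1F 2F _ → be
                          ; 1F 1F (s≤s ()) ; 2F 1F (s≤s ()) ; 2F 2F (s≤s (s≤s ())) }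
        ; δ-fresh     = λ i j i≢j e → disjoint (i≢j ∘ B-inj) x≢y (x∉B i ∘ sym) (y∉B i ∘ sym)
                          (x∉B j ∘ sym) (y∉B j ∘ sym) (trans e (sym xy))
        }) tower
      }
      where
      lift : ∀ j → ∃ λ j′ → (v ∷ᶠ x ∷ᶠ y ∷ᶠ []ᶠ) j ≡ (v ∷ᶠ x ∷ᶠ y ∷ᶠ B) j′
      lift 0F = 0F , refl
      lift 1F = 1F , refl
      lift 2F = 2F , refl
      extend : ∀ {w} → (∃ λ j → w ≡ (v ∷ᶠ x ∷ᶠ y ∷ᶠ []ᶠ) j) → ∃ λ j′ → w ≡ (v ∷ᶠ x ∷ᶠ y ∷ᶠ B) j′
      extend (j , p) = proj₁ (lift j) , trans p (proj₂ (lift j))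
      members : ∀ i → ∃ λ j → (a ∷ᶠ b ∷ᶠ e ∷ᶠ B) i ≡ (v ∷ᶠ x ∷ᶠ y ∷ᶠ B) j
      members 0F = extend (out 0F)
      members 1F = extend (out 1F)
      members 2F = extend (out 2F)
      members (suc (suc (suc i))) = suc (suc (suc i)) , refl

    by-cases : c x v ≡ X ⊎ c x v ≡ D ⊎ c x v ≡ O → c y v ≡ Y ⊎ c y v ≡ D ⊎ c y v ≡ O →
      Extension c (v ∷ᶠ x ∷ᶠ y ∷ᶠ B)
    by-cases (inj₁ p) (inj₁ q) = assemble ⟨01⟩ x≢y x≢v y≢v x∉B y∉B v∉B X≢Y X≢O Y≢O X≢D Y≢D (D≢O ∘ sym)
      xB yB vB xy p q (λ { 0F → 1F , refl ; 1F → 2F , refl ; 2F → 0F , refl })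
    -- S is a path with centre `y`, which therefore comes first; the colour `X` of `xv` puts `x`
    -- before `v`.
    by-cases (inj₁ p) (inj₂ (inj₁ q)) = assemble ⟨01,02⟩ (x≢y ∘ sym) y≢v x≢v y∉B x∉B v∉B (X≢Y ∘ sym) Y≢O X≢O
      Y≢D X≢D (D≢O ∘ sym) yB xB vB (flipˡ xy) q p (λ { 0F → 2F , refl ; 1F → 1F , refl ; 2F → 0F , refl })
    by-cases (inj₁ p) (inj₂ (inj₂ q)) = assemble ⟨02⟩ x≢v x≢y (y≢v ∘ sym) x∉B v∉B y∉B X≢O X≢Y (Y≢O ∘ sym)
      X≢D (D≢O ∘ sym) Y≢D xB vB yB p xy (flipˡ q) (λ { 0F → 1F , refl ; 1F → 0F , refl ; 2F → 2F , refl })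
    by-cases (inj₂ (inj₁ p)) (inj₁ q) = assemble ⟨01,02⟩ x≢y x≢v y≢v x∉B y∉B v∉B X≢Y X≢O Y≢O X≢D Y≢D (D≢O ∘ sym)
      xB yB vB xy p q (λ { 0F → 1F , refl ; 1F → 2F , refl ; 2F → 0F , refl })
    by-cases (inj₂ (inj₁ p)) (inj₂ (inj₁ q)) = ⊥-elim (no-mono△ (x≢v ∘ sym) (y≢v ∘ sym) x≢y
      (trans (flipˡ p) (sym (flipˡ q))) (trans (flipˡ p) (sym xy)))
    by-cases (inj₂ (inj₁ p)) (inj₂ (inj₂ q)) = assemble ⟨01,02⟩ x≢v x≢y (y≢v ∘ sym) x∉B v∉B y∉B X≢O X≢Y (Y≢O ∘ sym)
      X≢D (D≢O ∘ sym) Y≢D xB vB yB p xy (flipˡ q) (λ { 0F → 1F , refl ; 1F → 0F , refl ; 2F → 2F , refl })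
    by-cases (inj₂ (inj₂ p)) (inj₁ q) = assemble ⟨02⟩ y≢v (x≢y ∘ sym) (x≢v ∘ sym) y∉B v∉B x∉B Y≢O (X≢Y ∘ sym) (X≢O ∘ sym)
      Y≢D (D≢O ∘ sym) X≢D yB vB xB q (flipˡ xy) (flipˡ p) (λ { 0F → 2F , refl ; 1F → 0F , refl ; 2F → 1F , refl })
    by-cases (inj₂ (inj₂ p)) (inj₂ (inj₁ q)) = assemble ⟨01,02⟩ y≢v (x≢y ∘ sym) (x≢v ∘ sym) y∉B v∉B x∉B Y≢O (X≢Y ∘ sym) (X≢O ∘ sym)
      Y≢D (D≢O ∘ sym) X≢D yB vB xB q (flipˡ xy) (flipˡ p) (λ { 0F → 2F , refl ; 1F → 0F , refl ; 2F → 1F , refl })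
    by-cases (inj₂ (inj₂ p)) (inj₂ (inj₂ q)) = assemble ⟨12⟩ (x≢v ∘ sym) (y≢v ∘ sym) x≢y v∉B x∉B y∉B (X≢O ∘ sym) (Y≢O ∘ sym) X≢Y
      (D≢O ∘ sym) X≢D Y≢D vB xB yB (flipˡ p) (flipˡ q) xy (λ { 0F → 0F , refl ; 1F → 1F , refl ; 2F → 2F , refl })

  module _ {x y v} (f : Frame c x y v B) where
    open Frame f

    outer-colour-≢ : ∀ {i j} → i ≢ j → c v (B i) ≢ X
    outer-colour-≢ {i} {j} i≢j e = disjoint (v∉B i) (x∉B j) (x≢v ∘ sym) (v∉B j) (x∉B i ∘ sym) (i≢j ∘ B-inj)
      (trans e (sym (xB j)))

    outer-colour-≢ʳ : ∀ {i j} → i ≢ j → c v (B i) ≢ Y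
    outer-colour-≢ʳ {i} {j} i≢j e = disjoint (v∉B i) (y∉B j) (y≢v ∘ sym) (v∉B j) (y∉B i ∘ sym) (i≢j ∘ B-inj)
      (trans e (sym (yB j)))

    inner-colour-≢ : ∀ i → c v (B i) ≢ D
    inner-colour-≢ i e = disjoint (v∉B i) x≢y (x≢v ∘ sym) (y≢v ∘ sym) (x∉B i ∘ sym) (y∉B i ∘ sym)
      (trans e (sym xy))

    -- Otherwise the triangles of `x` and `B i` with `v` and with `y` are both rainbow, and no pinch
    -- is possible: `xv` has `O` and `xy` has `D`, while the edge from `v` to `B i` is disjoint from
    -- one of colour `Y`.
    new-colour-not-above : ∀ {i j} → i ≢ j → c v (B i) ≢ O → c x v ≢ O
    new-colour-not-above {i} {j} i≢j vi≢O xv≡O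
      with pinched (x∉B i) x≢v x≢y (v∉B i ∘ sym) (y∉B i ∘ sym) (y≢v ∘ sym)
        ((λ e → X≢O (trans (sym (xB i)) (trans e xv≡O))) ,
         (λ e → outer-colour-≢ i≢j (flipˡ (trans (sym e) (xB i)))) ,
         (λ e → vi≢O (flipˡ (trans (sym e) xv≡O))))
        ((λ e → X≢D (trans (sym (xB i)) (trans e xy))) ,
         (λ e → X≢Y (trans (sym (xB i)) (trans e (flipˡ (yB i))))) ,
         (λ e → Y≢D (trans (sym (flipˡ (yB i))) (trans (sym e) xy))))
    ... | inj₁ e = D≢O (trans (sym xy) (trans (sym e) xv≡O))
    ... | inj₂ e = outer-colour-≢ʳ i≢j (flipˡ (trans e (flipˡ (yB i))))

    module Mixed (xv≡D : c x v ≡ D)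
      (old-or-new : ∀ i → c v (B i) ≡ O ⊎ ∃ λ j → j ≢ i × c (B i) v ≡ c (B i) (B j))
      (O-fresh : ∀ i j → i ≢ j → c (B i) (B j) ≢ O) where

      -- The triangle on `v`, `B i`, `x` is rainbow because `xv` has colour `D`. If that on `v`,
      -- `B i`, `B j` were rainbow too, neither pinch would be possible.
      old-colour-decides : ∀ {i j} → i ≢ j → c v (B i) ≢ O →
        c v (B i) ≡ c (B i) (B j) ⊎ c v (B j) ≡ c (B i) (B j)
      old-colour-decides {i} {j} i≢j vi≢O with old-or-new i
      ... | inj₁ e = contradiction e vi≢O
      ... | inj₂ (z , z≢i , e) with c v (B i) ≟ c (B i) (B j) | c v (B j) ≟ c (B i) (B j)
      ...   | yes p | _     = inj₁ p
      ...   | _     | yes q = inj₂ q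
      ...   | no p  | no q
        with pinched (v∉B i) (x≢v ∘ sym) (v∉B j) (x∉B i ∘ sym) (i≢j ∘ B-inj) (x∉B j)
          ((λ e → inner-colour-≢ i (trans e (flipˡ xv≡D))) ,
           (λ e → outer-colour-≢ i≢j (trans e (flipˡ (xB i)))) ,
           (λ e → X≢D (trans (sym (flipˡ (xB i))) (trans (sym e) (flipˡ xv≡D)))))
          (vi≢vj , p , q)
        where
        -- The old colour of the edge from `v` to `B i` recurs at `B i`, so its class has centre
        -- `B i` and misses the edge from `v` to `B j`.
        vi≢vj : c v (B i) ≢ c v (B j)
        vi≢vj e′ with z ≟ j
        ... | yes refl = p (trans (symm v (B i)) e)
        ... | no z≢j   = disjoint (v∉B j) (z≢i ∘ B-inj ∘ sym) (v∉B i) (v∉B z) (i≢j ∘ sym ∘ B-inj) (z≢j ∘ sym ∘ B-inj)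
                           (trans (sym e′) (flipˡ e))
      ...     | inj₁ e′ = contradiction (trans (sym e′) (flipˡ xv≡D)) (inner-colour-≢ j)
      ...     | inj₂ e′ = ⊥-elim (no-mono△ (x∉B i) (x∉B j) (i≢j ∘ B-inj) (trans (xB i) (sym (xB j)))
                            (trans (symm x (B i)) e′))

      new-decides : ∀ {i j} → c v (B i) ≢ O → c v (B j) ≡ O → c v (B i) ≡ c (B i) (B j)
      new-decides {i} {j} vi≢O vj≡O with old-colour-decides {i} {j} (λ { refl → vi≢O vj≡O }) vi≢O
      ... | inj₁ e = e
      ... | inj₂ e = contradiction (trans (sym e) vj≡O) (O-fresh i j (λ { refl → vi≢O vj≡O }))

      -- For use with a top pair `a`, `b` of `B` and `d` below it. If `va` is old and `vb` new, `va`
      -- has colour `R`. A new `vd` would force `P` on `va`; an old `vd` has colour `Q`, and then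
      -- neither `va` nor `vd` has the colour `P` of `ad`.
      half-new-pair : ∀ {a b d P Q R} → a ≢ d → c (B a) (B d) ≡ P → c (B b) (B d) ≡ Q → c (B a) (B b) ≡ R →
        P ≢ Q → P ≢ R → c v (B a) ≢ O → c v (B b) ≢ O
      half-new-pair {a} {b} {d} a≢d ad bd ab P≢Q P≢R va≢O vb≡O with c v (B d) ≟ O
      ... | yes vd≡O = P≢R (trans (sym ad) (trans (sym (new-decides va≢O vd≡O)) (trans (new-decides va≢O vb≡O) ab)))
      ... | no vd≢O with old-colour-decides a≢d va≢O
      ...   | inj₁ e = P≢R (trans (sym ad) (trans (sym e) (trans (new-decides va≢O vb≡O) ab)))
      ...   | inj₂ e = P≢Q (trans (sym ad) (trans (sym e) (trans (new-decides vd≢O vb≡O) (flipˡ bd))))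

module TopOfB {n s j : ℕ} {c : Matrix n s} (l : Local c) {x y v} {B : Fin (2 + j) → Fin n}
  (f : Frame c x y v B) (pt : Fin j) (blk : IsBlock 2 pairEdges (restrict c B))
  (old-or-new : ∀ i → c v (B i) ≡ Frame.O f ⊎ ∃ λ j → j ≢ i × c (B i) v ≡ c (B i) (B j))
  (O-fresh : ∀ i j → i ≢ j → c (B i) (B j) ≢ Frame.O f) where
  open LocalTheory l
  open IsBlock blk

  -- If both edges from `v` to the top pair of `B` are old, one has the inner colour of the pair,
  -- while a new edge further down forces on it the colour sent down. If both are new, an old edge
  -- further down would need the downward colours of both pair vertices.
  not-mixed : ∀ {x y} (f′ : Frame c x y v B) → Frame.O f′ ≡ Frame.O f → c x v ≡ Frame.D f′ →
    ∀ {i₀ j₀} → c v (B i₀) ≢ Frame.O f → c v (B j₀) ≢ Frame.O f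
  not-mixed f′ refl xv≡D {i₀} {j₀} = by-cases (c v (B 0F) ≟ O) (c v (B 1F) ≟ O) i₀ j₀
    where
    open Frame f′ using (O)
    open FrameTheory.Mixed l f′ xv≡D old-or-new O-fresh
    by-cases : Dec (c v (B 0F) ≡ O) → Dec (c v (B 1F) ≡ O) →
      ∀ i₀ j₀ → c v (B i₀) ≢ O → c v (B j₀) ≢ O
    by-cases (no a) _ _ 0F _ = a
    by-cases _ (no b) _ 1F _ = b
    by-cases (no a) (yes b) _ _ _ _ =
      half-new-pair (λ ()) (cross 0F pt) (cross 1F pt) (inner 0F 1F (s≤s z≤n))
        (λ e → 0≢1+n (γ-injective e)) (γ≢δ 0F) a b
    by-cases (yes a) (no b) _ _ _ _ =
      half-new-pair (λ ()) (cross 1F pt) (cross 0F pt) (flipˡ (inner 0F 1F (s≤s z≤n)))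
        (λ e → 0≢1+n (sym (γ-injective e))) (γ≢δ 1F) b a
    by-cases (no a) (no b) _ (suc (suc j)) _ e with old-colour-decides {0F} {1F} (λ ()) a
    ... | inj₁ p = γ≢δ 0F (trans (sym (cross 0F j)) (trans (sym (new-decides a e)) (trans p (inner 0F 1F (s≤s z≤n)))))
    ... | inj₂ p = γ≢δ 1F (trans (sym (cross 1F j)) (trans (sym (new-decides b e)) (trans p (inner 0F 1F (s≤s z≤n)))))
    by-cases (yes a) _ 0F _ i≢O _ = i≢O a
    by-cases _ (yes b) 1F _ i≢O _ = i≢O b
    by-cases (yes a) (yes b) (suc (suc i)) _ i≢O _ = 0≢1+n (γ-injective (trans (sym (cross 0F i))
      (trans (flip≡ (trans (sym (new-decides i≢O a)) (new-decides i≢O b))) (cross 1F i))))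

  -- Given an old edge from `v` to `B`, neither `xv` nor `yv` is new, so a new edge goes to `B`.
  -- Then `not-mixed` rules out `D` above, and only the excluded combination of `X` and `Y` remains.
  all-new : (c x v ≡ Frame.X f → c y v ≢ Frame.Y f) →
    c x v ≡ Frame.O f ⊎ c y v ≡ Frame.O f ⊎ (∃ λ i → c v (B i) ≡ Frame.O f) →
    ∀ i → c v (B i) ≡ Frame.O f
  all-new ¬XY new i with old-or-new i
  ... | inj₁ e = e
  ... | inj₂ (z , z≢i , _) = decidable-stable (_ ≟ _) λ vi≢O → case vi≢O
    where
    open Frame f
    open FrameTheory l using (flip-frame; new-colour-not-above)
    case : c v (B i) ≢ O → ⊥
    case vi≢O = go xv yv new
      where
      ¬xO = new-colour-not-above f (z≢i ∘ sym) vi≢O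
      ¬yO = new-colour-not-above (flip-frame f) (z≢i ∘ sym) vi≢O
      go : c x v ≡ X ⊎ c x v ≡ D ⊎ c x v ≡ O → c y v ≡ Y ⊎ c y v ≡ D ⊎ c y v ≡ O →
        c x v ≡ O ⊎ c y v ≡ O ⊎ (∃ λ i → c v (B i) ≡ O) → ⊥
      go _ _ (inj₁ e) = ¬xO e
      go _ _ (inj₂ (inj₁ e)) = ¬yO e
      go (inj₂ (inj₂ e)) _ _ = ¬xO e
      go _ (inj₂ (inj₂ e)) _ = ¬yO e
      go (inj₂ (inj₁ e)) _ (inj₂ (inj₂ (_ , vj≡O))) = not-mixed f refl e vi≢O vj≡O
      go _ (inj₂ (inj₁ e)) (inj₂ (inj₂ (_ , vj≡O))) = not-mixed (flip-frame f) refl e vi≢O vj≡O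
      go (inj₁ p) (inj₁ q) _ = ¬XY p q

-- An edge from `v` either is new or repeats a colour at its other end. The colours at a pair vertex
-- are the one it sends to `B` and that of the pair, whence the three options for `xv` and `yv`.
frame : ∀ {n N s} {c : Matrix N s} → Local c → {g : Fin (2 + n) → Fin N} {v : Fin N} →
  Injective _≡_ _≡_ g → IsBlock 2 pairEdges (restrict c g) → Fin n → (∀ i → v ≢ g i) →
  ∀ O → (∀ i → c v (g i) ≡ O ⊎ ∃ λ j → j ≢ i × c (g i) v ≡ c (g i) (g j)) →
  (∀ i j → i ≢ j → c (g i) (g j) ≢ O) → Frame c (g 0F) (g 1F) v (λ i → g (suc (suc i)))
frame {c = c} l {g} {v} inj blk pt v∉ O old-or-new O-fresh = record
  { x≢y = (λ ()) ∘ inj ; x≢v = v∉ 0F ∘ sym ; y≢v = v∉ 1F ∘ sym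
  ; x∉B = λ i → (λ ()) ∘ inj ; y∉B = λ i → (λ ()) ∘ inj ; v∉B = λ i → v∉ (suc (suc i))
  ; B-inj = suc-injective ∘ suc-injective ∘ inj
  ; X = γ 0F ; Y = γ 1F ; D = δ ; O = O
  ; X≢Y = 0≢1+n ∘ γ-injective ; X≢D = γ≢δ 0F ; Y≢D = γ≢δ 1F
  ; X≢O = λ e → O-fresh 0F (suc (suc pt)) (λ ()) (trans (cross 0F pt) e)
  ; Y≢O = λ e → O-fresh 1F (suc (suc pt)) (λ ()) (trans (cross 1F pt) e)
  ; D≢O = λ e → O-fresh 0F 1F (λ ()) (trans xy e)
  ; xB = cross 0F ; yB = cross 1F ; xy = xy
  ; xv = x-colour (old-or-new 0F) ; yv = y-colour (old-or-new 1F)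
  }
  where
  open LocalTheory l
  open IsBlock blk
  xy : c (g 0F) (g 1F) ≡ δ
  xy = inner 0F 1F (s≤s z≤n)
  x-colour : c v (g 0F) ≡ O ⊎ (∃ λ j → j ≢ 0F × c (g 0F) v ≡ c (g 0F) (g j)) →
    c (g 0F) v ≡ γ 0F ⊎ c (g 0F) v ≡ δ ⊎ c (g 0F) v ≡ O
  x-colour (inj₁ e) = inj₂ (inj₂ (flipˡ e))
  x-colour (inj₂ (0F , ne , _)) = contradiction refl ne
  x-colour (inj₂ (1F , _ , e)) = inj₂ (inj₁ (trans e xy))
  x-colour (inj₂ (suc (suc j) , _ , e)) = inj₁ (trans e (cross 0F j))
  y-colour : c v (g 1F) ≡ O ⊎ (∃ λ j → j ≢ 1F × c (g 1F) v ≡ c (g 1F) (g j)) →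
    c (g 1F) v ≡ γ 1F ⊎ c (g 1F) v ≡ δ ⊎ c (g 1F) v ≡ O
  y-colour (inj₁ e) = inj₂ (inj₂ (flipˡ e))
  y-colour (inj₂ (1F , ne , _)) = contradiction refl ne
  y-colour (inj₂ (0F , _ , e)) = inj₂ (inj₁ (trans e (flipˡ xy)))
  y-colour (inj₂ (suc (suc j) , _ , e)) = inj₁ (trans e (cross 1F j))

within-≡ : {c : Matrix n s} {f f′ : Fin m → Fin n} → (∀ i → ∃ λ j → f i ≡ f′ j) →
  Extension c f → Extension c f′
within-≡ h e = record
  { vertices  = vertices
  ; injective = injective
  ; within    = λ i → let j , p = within i ; j′ , q = h j in j′ , trans p q
  ; tower     = tower
  }
  where open Extension e

module Readd {N s} {c : Matrix N s} (l : Local c) {v : Fin N} (O : Fin s) where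
  open Local l
  open LocalTheory l

  -- The situation of a vertex deleted from an extremal colouring of even order: `O` is the colour
  -- lost with it, and any other edge at `v` repeats a colour at its far end.
  record OneNewColour {n} (g : Fin n → Fin N) : Set where
    field
      injective  : Injective _≡_ _≡_ g
      v∉         : ∀ i → v ≢ g i
      old-or-new : ∀ i → c v (g i) ≡ O ⊎ ∃ λ j → j ≢ i × c (g i) v ≡ c (g i) (g j)
      O-fresh    : ∀ i j → i ≢ j → c (g i) (g j) ≢ O
      new        : ∃ λ i → c v (g i) ≡ O

  head-cases : {g : Fin (2 + n) → Fin N} → OneNewColour g →
    c (g 0F) v ≡ O ⊎ c (g 1F) v ≡ O ⊎ ∃ λ i → c v (g (suc (suc i))) ≡ O
  head-cases h with OneNewColour.new h
  ... | 0F , e = inj₁ (flipˡ e)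
  ... | 1F , e = inj₂ (inj₁ (flipˡ e))
  ... | suc (suc i) , e = inj₂ (inj₂ (i , e))

  as-cons : {g : Fin (2 + n) → Fin N} → ∀ i →
    ∃ λ j → (v ∷ᶠ g 0F ∷ᶠ g 1F ∷ᶠ (λ i → g (suc (suc i)))) i ≡ (v ∷ᶠ g) j
  as-cons 0F = 0F , refl
  as-cons 1F = 1F , refl
  as-cons 2F = 2F , refl
  as-cons (suc (suc (suc i))) = suc (suc (suc i)) , refl

  three-block : {g : Fin 3 → Fin N} → Rainbow△ c (g 0F) (g 1F) (g 2F) →
    IsBlock 2 pairEdges (restrict c g)
  three-block {g} (p , q , r) = record
    { γ           = c (g 0F) (g 2F) ∷ᶠ c (g 1F) (g 2F) ∷ᶠ []ᶠ
    ; γ-injective = pair-injective r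
    ; δ           = c (g 0F) (g 1F)
    ; γ≢δ         = λ { 0F → p ∘ sym ; 1F → q ∘ sym }
    ; cross       = λ { 0F 0F → refl ; 1F 0F → refl }
    ; inner       = λ { 0F 1F _ → refl ; 1F 1F (s≤s ()) }
    ; δ-fresh     = λ { 0F 0F ne → contradiction refl ne }
    }

  last-new : {g : Fin 3 → Fin N} → OneNewColour g → Rainbow△ c (g 0F) (g 1F) (g 2F) →
    c v (g 2F) ≡ O → Extension c (v ∷ᶠ g)
  last-new h rb e = within-≡ as-cons (FrameTheory.triple-extension l
    (frame l injective (three-block rb) 0F v∉ O old-or-new O-fresh) single λ { 0F → e })
    where open OneNewColour h

  permute : {g : Fin n → Fin N} (π : Fin n → Fin n) → (∀ i → π (π i) ≡ i) →
    OneNewColour g → OneNewColour (g ∘ π)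
  permute {g = g} π inv h = record
    { injective  = π-inj ∘ injective
    ; v∉         = v∉ ∘ π
    ; old-or-new = λ i → swapped (old-or-new (π i))
    ; O-fresh    = λ i j i≢j → O-fresh _ _ (i≢j ∘ π-inj)
    ; new        = let i , e = new in π i , trans (cong (c v ∘ g) (inv i)) e
    }
    where
    open OneNewColour h
    π-inj : Injective _≡_ _≡_ π
    π-inj {i} {j} e = trans (sym (inv i)) (trans (cong π e) (inv j))
    swapped : ∀ {i} → c v (g (π i)) ≡ O ⊎ (∃ λ j → j ≢ π i × c (g (π i)) v ≡ c (g (π i)) (g j)) →
      c v (g (π i)) ≡ O ⊎ ∃ λ j → j ≢ i × c (g (π i)) v ≡ c (g (π i)) (g (π j))
    swapped (inj₁ e) = inj₁ e
    swapped {i} (inj₂ (j , ne , e)) =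
      inj₂ (π j , (λ { refl → ne (sym (inv j)) }) , trans e (cong (c (g (π i)) ∘ g) (sym (inv j))))

  permuted : {g : Fin n → Fin N} (π : Fin n → Fin n) →
    ∀ i → ∃ λ j → (v ∷ᶠ (g ∘ π)) i ≡ (v ∷ᶠ g) j
  permuted π zero    = zero , refl
  permuted π (suc i) = suc (π i) , refl

  swap₀₂ swap₁₂ : Fin 3 → Fin 3
  swap₀₂ = 2F ∷ᶠ 1F ∷ᶠ 0F ∷ᶠ []ᶠ
  swap₁₂ = 0F ∷ᶠ 2F ∷ᶠ 1F ∷ᶠ []ᶠ

  -- One vertex below the pair is too few for `not-mixed`. Instead a rainbow triangle is symmetric,
  -- so a vertex joined to `v` by the new colour can be put at the bottom.
  three : {g : Fin 3 → Fin N} → OneNewColour g → Rainbow△ c (g 0F) (g 1F) (g 2F) → Extension c (v ∷ᶠ g)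
  three h (p , q , r) with OneNewColour.new h
  ... | 0F , e = within-≡ (permuted swap₀₂) (last-new (permute swap₀₂ (λ { 0F → refl ; 1F → refl ; 2F → refl }) h)
                   ((λ e → r (sym (flip≡ e))) , (λ e → q (sym (flip≡ e))) , (λ e → p (sym (flip≡ e)))) e)
  ... | 1F , e = within-≡ (permuted swap₁₂) (last-new (permute swap₁₂ (λ { 0F → refl ; 1F → refl ; 2F → refl }) h)
                   (p ∘ sym , (λ e → r (trans e (symm _ _))) , (λ e → q (trans e (symm _ _)))) e)
  ... | 2F , e = last-new h (p , q , r) e

  readd : ∀ {n} {o : Odd n} {g : Fin (2 + n) → Fin N} → IsBlock 2 pairEdges (restrict c g) →
    OddTower o (restrict c (λ i → g (suc (suc i)))) → OneNewColour g → Extension c (v ∷ᶠ g)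
  readd {g = g} blk single h = three h
    ((λ e → γ≢δ 0F (trans (sym (cross 0F 0F)) (trans (sym e) (inner 0F 1F (s≤s z≤n))))) ,
     (λ e → γ≢δ 1F (trans (sym (cross 1F 0F)) (trans (sym e) (inner 0F 1F (s≤s z≤n))))) ,
     (λ e → 0≢1+n (γ-injective (trans (sym (cross 0F 0F)) (trans e (cross 1F 0F))))))
    where open IsBlock blk
  readd {g = g} blk t@(pair {o = o} blk′ t′) h = by-cases (c x v ≟ X) (c y v ≟ Y)
    where
    open OneNewColour h
    f = frame l injective blk 0F v∉ O old-or-new O-fresh
    open Frame f using (X; Y; X≢O; Y≢O; x∉B; y∉B; x≢y; x≢v; y≢v; xB; yB; xy; v∉B; B-inj)
    open FrameTheory l using (outer-colour-≢; outer-colour-≢ʳ)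
    x = g 0F
    y = g 1F
    B = λ i → g (suc (suc i))

    -- The repeated colour cannot be `X` or `Y`: those classes contain an edge from `x` or `y` to
    -- another vertex of `B`, disjoint from the edge at `v`.
    restrict-old-or-new : ∀ i → c v (B i) ≡ O ⊎ ∃ λ j → j ≢ i × c (B i) v ≡ c (B i) (B j)
    restrict-old-or-new i with old-or-new (suc (suc i))
    ... | inj₁ e = inj₁ e
    ... | inj₂ (0F , _ , e) = contradiction (trans (flipˡ e) (trans (symm (B i) x) (xB i)))
                                (outer-colour-≢ f (proj₂ (another i)))
    ... | inj₂ (1F , _ , e) = contradiction (trans (flipˡ e) (trans (symm (B i) y) (yB i)))
                                (outer-colour-≢ʳ f (proj₂ (another i)))
    ... | inj₂ (suc (suc j) , ne , e) = inj₂ (j , (λ { refl → ne refl }) , e)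

    restrict-O-fresh : ∀ i j → i ≢ j → c (B i) (B j) ≢ O
    restrict-O-fresh i j i≢j = O-fresh _ _ (i≢j ∘ suc-injective ∘ suc-injective)

    below : c x v ≡ X → c y v ≡ Y → OneNewColour B
    below p q = record
      { injective  = B-inj
      ; v∉         = v∉B
      ; old-or-new = restrict-old-or-new
      ; O-fresh    = restrict-O-fresh
      ; new        = find (head-cases h)
      }
      where
      find : c x v ≡ O ⊎ c y v ≡ O ⊎ (∃ λ i → c v (B i) ≡ O) → ∃ λ i → c v (B i) ≡ O
      find (inj₁ e) = contradiction (trans (sym p) e) X≢O
      find (inj₂ (inj₁ e)) = contradiction (trans (sym q) e) Y≢O
      find (inj₂ (inj₂ e)) = e

    on-top : c x v ≡ X → c y v ≡ Y → Extension c (v ∷ᶠ B) → Extension c (v ∷ᶠ g)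
    on-top p q e = record
      { vertices  = x ∷ᶠ y ∷ᶠ E.vertices
      ; injective = ∷-injective (∷-avoids x≢y x∉) (∷-injective y∉ E.injective)
      ; within    = within
      ; tower     = pair (record
        { γ           = IsBlock.γ blk
        ; γ-injective = IsBlock.γ-injective blk
        ; δ           = IsBlock.δ blk
        ; γ≢δ         = IsBlock.γ≢δ blk
        ; cross       = λ { 0F i → cross-x i ; 1F i → cross-y i }
        ; inner       = λ { 0F 1F → IsBlock.inner blk 0F 1F ; 1F 1F (s≤s ()) }
        ; δ-fresh     = λ i j i≢j e → disjoint (i≢j ∘ E.injective) x≢y (x∉ i ∘ sym) (y∉ i ∘ sym)
                          (x∉ j ∘ sym) (y∉ j ∘ sym) (trans e (sym xy))
        }) E.tower
      }
      where
      module E = Extension e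
      everywhere : (P : Fin N → Set) → P v → (∀ i → P (B i)) → ∀ i → P (E.vertices i)
      everywhere P pv pB i with E.within i
      ... | zero  , q = subst P (sym q) pv
      ... | suc j , q = subst P (sym q) (pB j)
      x∉ = everywhere (x ≢_) x≢v x∉B
      y∉ = everywhere (y ≢_) y≢v y∉B
      cross-x = everywhere (λ w → c x w ≡ X) p xB
      cross-y = everywhere (λ w → c y w ≡ Y) q yB
      within : ∀ i → ∃ λ j → (x ∷ᶠ y ∷ᶠ E.vertices) i ≡ (v ∷ᶠ g) j
      within 0F = 1F , refl
      within 1F = 2F , refl
      within (suc (suc i)) with E.within i
      ... | zero  , q = zero , q
      ... | suc j , q = suc (suc (suc j)) , q

    by-cases : Dec (c x v ≡ X) → Dec (c y v ≡ Y) → Extension c (v ∷ᶠ g)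
    by-cases (yes p) (yes q) = on-top p q (readd blk′ t′ (below p q))
    by-cases (no p) _ = within-≡ as-cons (FrameTheory.triple-extension l f t
      (TopOfB.all-new l f (point o) blk′ restrict-old-or-new restrict-O-fresh (λ e → contradiction e p) (head-cases h)))
    by-cases _ (no q) = within-≡ as-cons (FrameTheory.triple-extension l f t
      (TopOfB.all-new l f (point o) blk′ restrict-old-or-new restrict-O-fresh (λ _ → q) (head-cases h)))

-- Counting colours

injective⇒surjective : {f : Fin n → Fin n} → Injective _≡_ _≡_ f → ∀ y → ∃ λ x → f x ≡ y
injective⇒surjective {f = f} inj y with any? (λ x → f x ≟ y)
... | yes p = p
... | no ¬p = contradiction (injective⇒≤ (∷-injective (λ i e → ¬p (i , sym e)) inj)) 1+n≰n

-- The recursion follows the blocks: a pair adds two vertices and three colours. The closed form is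
-- `bound-formula`.
bound : ℕ → ℕ
bound 0                   = 0
bound 1                   = 0
bound 2                   = 1
bound (suc (suc (suc n))) = 3 + bound (suc n)

odd-or-suc-odd : ∀ n → Odd n ⊎ Odd (suc n)
odd-or-suc-odd zero = inj₂ one
odd-or-suc-odd (suc zero) = inj₁ one
odd-or-suc-odd (suc (suc n)) with odd-or-suc-odd n
... | inj₁ o = inj₁ (step o)
... | inj₂ o = inj₂ (step o)

¬odd-odd : Odd n → ¬ Odd (suc n)
¬odd-odd one (step ())
¬odd-odd (step o) (step o′) = ¬odd-odd o o′

-- The growth by 1 into even order, and by 2 into odd order below, matches the losses that a
-- suitable deletion guarantees.
bound-suc-odd : Odd n → bound (suc n) ≡ 1 + bound n
bound-suc-odd one             = refl
bound-suc-odd (step one)      = refl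
bound-suc-odd (step (step o)) = cong (3 +_) (bound-suc-odd (step o))

bound-odd : Odd (suc (suc n)) → bound (suc (suc n)) ≡ 2 + bound (suc n)
bound-odd (step one)      = refl
bound-odd (step (step o)) = cong (3 +_) (bound-odd (step o))

Used : Matrix n s → Fin s → Set
Used c k = ∃₂ λ a b → a ≢ b × c a b ≡ k

used? : (c : Matrix n s) → Decidable (Used c)
used? c k = any? λ a → any? λ b → ¬? (a ≟ b) ×-dec (c a b ≟ k)

length-split : {P : A → Set} (P? : Decidable P) (xs : List A) →
  length xs ≡ length (filter P? xs) + length (filter (¬? ∘ P?) xs)
length-split P? [] = refl
length-split P? (x ∷ xs) with P? x
... | yes _ = cong suc (length-split P? xs)
... | no _  = trans (cong suc (length-split P? xs)) (sym (+-suc _ _))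

delete : Matrix (suc n) s → Fin (suc n) → Matrix n s
delete c v = restrict c (punchIn v)

local-delete : {c : Matrix (suc n) s} → Local c → ∀ v → Local (delete c v)
local-delete l v = local-restrict l (punchIn-injective v _ _)

module Removal {n s : ℕ} {c : Matrix (suc n) s} (l : Local c) (v : Fin (suc n)) where
  open Local l
  open LocalTheory l

  used-delete : ∀ {a b k} → v ≢ a → v ≢ b → a ≢ b → c a b ≡ k → Used (delete c v) k
  used-delete v≢a v≢b a≢b e = punchOut v≢a , punchOut v≢b ,
    (λ q → a≢b (trans (sym (punchIn-punchOut v≢a)) (trans (cong (punchIn v) q) (punchIn-punchOut v≢b)))) ,
    trans (cong₂ c (punchIn-punchOut v≢a) (punchIn-punchOut v≢b)) e

  -- All edges of a lost colour contain `v`; another one at the far end, avoiding `v`, would have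
  -- survived.
  lost⇒saturated : ∀ {k} → Used c k → ¬ Used (delete c v) k → ∃ λ a → Saturated c v a × c v a ≡ k
  lost⇒saturated {k} (a , b , a≢b , e) lost = at-v (v ≟ a) (v ≟ b)
    where
    saturated : ∀ b → v ≢ b → c v b ≡ k → ∃ λ a → Saturated c v a × c v a ≡ k
    saturated b v≢b e = b , (v≢b , λ z z≢v z≢b f →
      lost (used-delete v≢b (z≢v ∘ sym) (z≢b ∘ sym) (trans f (flipˡ e)))) , e
    at-v : Dec (v ≡ a) → Dec (v ≡ b) → ∃ λ a → Saturated c v a × c v a ≡ k
    at-v (yes refl) _ = saturated b a≢b e
    at-v _ (yes refl) = saturated a (a≢b ∘ sym) (flipˡ e)
    at-v (no v≢a) (no v≢b) = contradiction (used-delete v≢a v≢b a≢b e) lost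

  kept lost : List (Fin s) → List (Fin s)
  kept = filter (used? (delete c v))
  lost = filter (¬? ∘ used? (delete c v))

  lost-saturated : ∀ {ks} → All (Used c) ks → All (λ k → ∃ λ a → Saturated c v a × c v a ≡ k) (lost ks)
  lost-saturated {ks} u = All.zipWith (λ (p , q) → lost⇒saturated p q)
    (All.filter⁺ (¬? ∘ used? (delete c v)) u , All.all-filter (¬? ∘ used? (delete c v)) ks)

  lost≤2 : ∀ {ks} → Unique ks → All (λ k → ∃ λ a → Saturated c v a × c v a ≡ k) ks → length ks ≤ 2
  lost≤2 {[]} _ _ = z≤n
  lost≤2 {_ ∷ []} _ _ = s≤s z≤n
  lost≤2 {_ ∷ _ ∷ []} _ _ = s≤s (s≤s z≤n)
  lost≤2 {_ ∷ _ ∷ _ ∷ _} ((p ∷ q ∷ _) ∷ (r ∷ _) ∷ _) ((_ , sa , refl) ∷ (_ , sb , refl) ∷ (_ , sd , refl) ∷ _) =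
    ⊥-elim (no-three-saturated sa sb sd p q r)

  lost≤1 : ¬ TwoSaturated c v → ∀ {ks} → Unique ks →
    All (λ k → ∃ λ a → Saturated c v a × c v a ≡ k) ks → length ks ≤ 1
  lost≤1 ¬two {[]} _ _ = z≤n
  lost≤1 ¬two {_ ∷ []} _ _ = s≤s z≤n
  lost≤1 ¬two {_ ∷ _ ∷ _} ((p ∷ _) ∷ _) ((_ , sa , refl) ∷ (_ , sb , refl) ∷ _) =
    contradiction (_ , _ , sa , sb , p) ¬two

  lost-unique : ∀ {ks} → Unique ks → Unique (lost ks)
  lost-unique = Unique.filter⁺ (¬? ∘ used? (delete c v))

  kept-unique : ∀ {ks} → Unique ks → Unique (kept ks)
  kept-unique = Unique.filter⁺ (used? (delete c v))

  kept-used : ∀ ks → All (Used (delete c v)) (kept ks)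
  kept-used = All.all-filter (used? (delete c v))

  length-kept-lost : ∀ ks → length ks ≡ length (kept ks) + length (lost ks)
  length-kept-lost = length-split (used? (delete c v))

  length≤2+kept : ∀ {ks} → Unique ks → All (Used c) ks → length ks ≤ 2 + length (kept ks)
  length≤2+kept {ks} u us = begin
    length ks                          ≡⟨ length-kept-lost ks ⟩
    length (kept ks) + length (lost ks) ≤⟨ +-monoʳ-≤ (length (kept ks)) (lost≤2 (lost-unique u) (lost-saturated us)) ⟩
    length (kept ks) + 2               ≡⟨ ℕ.+-comm _ 2 ⟩
    2 + length (kept ks)               ∎
    where open ≤-Reasoning

  length≤1+kept : ¬ TwoSaturated c v → ∀ {ks} → Unique ks → All (Used c) ks → length ks ≤ 1 + length (kept ks)
  length≤1+kept ¬two {ks} u us = begin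
    length ks                          ≡⟨ length-kept-lost ks ⟩
    length (kept ks) + length (lost ks) ≤⟨ +-monoʳ-≤ (length (kept ks)) (lost≤1 ¬two (lost-unique u) (lost-saturated us)) ⟩
    length (kept ks) + 1               ≡⟨ ℕ.+-comm _ 1 ⟩
    1 + length (kept ks)               ∎
    where open ≤-Reasoning

-- Otherwise `odd-tower` would make the even order `2 + n` odd.
not-all-two : ∀ {n} {c : Matrix (2 + n) s} → Local c → Odd (suc n) → ∃ λ v → ¬ TwoSaturated c v
not-all-two {c = c} l o = ¬∀⟶∃¬ _ _ (twoSaturated? c)
  λ two-sat → ¬odd-odd o (proj₁ (odd-tower _ c l (inj₂ two-sat)))

-- Deletion keeps the palette `Fin s` while fewer colours survive, so colours are counted by
-- duplicate-free lists of used ones.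
colour-bound : ∀ n (c : Matrix (suc n) s) → Local c → ∀ {ks} → Unique ks → All (Used c) ks →
  length ks ≤ bound (suc n)
colour-bound zero c l {[]} u us = z≤n
colour-bound zero c l {k ∷ ks} u ((0F , 0F , ne , _) ∷ _) = contradiction refl ne
colour-bound (suc n) c l {ks} u us with odd-or-suc-odd (suc n)
... | inj₁ o =
  let v , ¬two = not-all-two l o
      open Removal l v
  in ≤-trans (length≤1+kept ¬two u us)
       (≤-trans (s≤s (colour-bound n (delete c v) (local-delete l v) (kept-unique u) (kept-used ks)))
         (≤-reflexive (sym (bound-suc-odd o))))
... | inj₂ o =
  let open Removal l zero
  in ≤-trans (length≤2+kept u us)
       (≤-trans (s≤s (s≤s (colour-bound n (delete c zero) (local-delete l zero) (kept-unique u) (kept-used ks))))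
         (≤-reflexive (sym (bound-odd o))))

-- Deleting a vertex without two saturated colours would leave one colour more than the even order
-- below allows.
extremal-odd : ∀ {n} {c : Matrix (suc n) s} → Local c → Odd (suc n) → ∀ {ks} → Unique ks → All (Used c) ks →
  bound (suc n) ≤ length ks → n ≡ 0 ⊎ (∀ v → TwoSaturated c v)
extremal-odd {n = zero} l o u us large = inj₁ refl
extremal-odd {n = suc n} {c} l o {ks} u us large = inj₂ λ v → decidable-stable (twoSaturated? c v) λ ¬two →
  let open Removal l v
      open ≤-Reasoning
  in 1+n≰n (begin
    2 + bound (suc n)     ≡⟨ bound-odd o ⟨
    bound (2 + n)         ≤⟨ large ⟩
    length ks             ≤⟨ length≤1+kept ¬two u us ⟩
    1 + length (kept ks)  ≤⟨ s≤s (colour-bound n (delete c v) (local-delete l v) (kept-unique u) (kept-used ks)) ⟩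
    1 + bound (suc n)     ∎)

readd-all : ∀ {n} {c : Matrix (2 + n) s} (l : Local c) {v O} {o : Odd (suc n)} {g : Fin (suc n) → Fin (2 + n)} →
  1 ≤ n → OddTower o (restrict c g) → Readd.OneNewColour l {v} O g → Extension c id
readd-all l {O = O} 1≤n (pair blk t) h = within-≡ (λ i → _ , refl) (Readd.readd l O blk t h)

module _ {n s : ℕ} {c : Matrix (suc n) s} (l : Local c) {v : Fin (suc n)} (¬two : ¬ TwoSaturated c v) where
  open Removal l v

  -- Each edge at `v` is saturated, and then has the colour of `va` because `v` lacks two saturated
  -- colours, or is dominated from its far end, where its colour recurs.
  one-new-colour : ∀ {a g} → Saturated c v a → ¬ Used (delete c v) (c v a) → Injective _≡_ _≡_ g →
    Readd.OneNewColour l {v} (c v a) (punchIn v ∘ g)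
  one-new-colour {a} {g} sa fresh inj = record
    { injective  = λ e → inj (punchIn-injective v _ _ e)
    ; v∉         = v∉
    ; old-or-new = λ i → classify i (saturated-or-dominates c (v∉ i))
    ; O-fresh    = λ i j i≢j e → fresh (g i , g j , i≢j ∘ inj , e)
    ; new        = let j , e = onto a (proj₁ sa) in j , cong (c v) e
    }
    where
    v∉ : ∀ i → v ≢ punchIn v (g i)
    v∉ i e = punchInᵢ≢i v (g i) (sym e)
    onto : ∀ x → v ≢ x → ∃ λ j → punchIn v (g j) ≡ x
    onto x v≢x = let j , e = injective⇒surjective inj (punchOut v≢x) in
      j , trans (cong (punchIn v) e) (punchIn-punchOut v≢x)
    classify : ∀ i → Saturated c v (punchIn v (g i)) ⊎ Dominates c (punchIn v (g i)) v →
      c v (punchIn v (g i)) ≡ c v a ⊎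
      ∃ λ j → j ≢ i × c (punchIn v (g i)) v ≡ c (punchIn v (g i)) (punchIn v (g j))
    classify i (inj₁ s) = inj₁ (decidable-stable (_ ≟ _) λ ne → ¬two (_ , _ , s , sa , ne))
    classify i (inj₂ (_ , z , z≢v , z≢x , e)) = let j , p = onto z (z≢v ∘ sym) in
      inj₂ (j , (λ { refl → z≢x (sym p) }) , trans (sym e) (cong (c _) (sym p)))

extremal-even : ∀ {n} {c : Matrix (2 + n) s} → Local c → Odd (suc n) → 1 ≤ n →
  ∀ {ks} → Unique ks → All (Used c) ks → bound (2 + n) ≤ length ks → Extension c id
extremal-even {n = n} {c} l o 1≤n {ks} u us large =
  let v , ¬two = not-all-two l o
      open Removal l v
      open ≤-Reasoning
      kept≤ = colour-bound n (delete c v) (local-delete l v) (kept-unique u) (kept-used ks)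
      ≤kept : bound (suc n) ≤ length (kept ks)
      ≤kept = +-cancelˡ-≤ 1 _ _ (begin
        1 + bound (suc n)    ≡⟨ bound-suc-odd o ⟨
        bound (2 + n)        ≤⟨ large ⟩
        length ks            ≤⟨ length≤1+kept ¬two u us ⟩
        1 + length (kept ks) ∎)
      -- The rest alone has too few colours, so some colour is lost with `v`; it becomes the new
      -- colour `O`.
      0<lost : length (lost ks) ≢ 0
      0<lost = λ e → 1+n≰n (begin
        1 + bound (suc n)                   ≡⟨ bound-suc-odd o ⟨
        bound (2 + n)                       ≤⟨ large ⟩
        length ks                           ≡⟨ length-kept-lost ks ⟩
        length (kept ks) + length (lost ks) ≡⟨ cong (length (kept ks) +_) e ⟩
        length (kept ks) + 0                ≡⟨ ℕ.+-identityʳ _ ⟩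
        length (kept ks)                    ≤⟨ kept≤ ⟩
        bound (suc n)                       ∎)
      k , k-used , k-lost = some-lost 0<lost (All.filter⁺ (¬? ∘ used? (delete c v)) us)
                              (All.all-filter (¬? ∘ used? (delete c v)) ks)
      a , sa , va≡k = lost⇒saturated k-used k-lost
      o′ , g , inj , t = odd-tower n (delete c v) (local-delete l v)
        (extremal-odd (local-delete l v) o (kept-unique u) (kept-used ks) ≤kept)
  in readd-all l 1≤n t (one-new-colour l ¬two sa (subst (¬_ ∘ Used (delete c v)) (sym va≡k) k-lost) inj)
  where
  some-lost : ∀ {P Q : Fin _ → Set} {ks} → length ks ≢ 0 → All P ks → All Q ks → ∃ λ k → P k × Q k
  some-lost ne [] [] = contradiction refl ne
  some-lost ne (p ∷ _) (q ∷ _) = _ , p , q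

-- From star-colourings to local conditions

module _ {n s : ℕ} (c : Colouring n s) where

  class-centre : IsStarColouring c → ∀ k →
    ∃ λ z → ∀ {a b} → a ≢ b → colour c a b ≡ k → a ≡ z ⊎ b ≡ z
  class-centre star k with star k
  ... | m , _ , f , _ , edges = f zero , λ a≢b e → at-centre (Equivalence.to (edges _ _) (a≢b , e))
    where
    at-centre : ∀ {a b} → (∃₂ λ u w → Adj (K₁, m) u w × f u ≡ a × f w ≡ b) → a ≡ f zero ⊎ b ≡ f zero
    at-centre (u , w , inj₁ (refl , _) , p , q) = inj₁ (sym p)
    at-centre (u , w , inj₂ (_ , refl) , p , q) = inj₂ (sym q)

  -- The edge common to the two triangles comes first, followed by the other two edges of each
  -- triangle.
  K₄⁻-end : Fin 5 → Fin 4 × Fin 4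
  K₄⁻-end 0F = 0F , 1F
  K₄⁻-end 1F = 0F , 2F
  K₄⁻-end 2F = 1F , 2F
  K₄⁻-end 3F = 0F , 3F
  K₄⁻-end 4F = 1F , 3F

  K₄⁻-edge : ∀ u w → Adj K₄⁻ u w → ∃ λ e → SameEdge u w (proj₁ (K₄⁻-end e)) (proj₂ (K₄⁻-end e))
  K₄⁻-edge 0F 1F _ = 0F , inj₁ (refl , refl)
  K₄⁻-edge 0F 2F _ = 1F , inj₁ (refl , refl)
  K₄⁻-edge 1F 2F _ = 2F , inj₁ (refl , refl)
  K₄⁻-edge 0F 3F _ = 3F , inj₁ (refl , refl)
  K₄⁻-edge 1F 3F _ = 4F , inj₁ (refl , refl)
  K₄⁻-edge 1F 0F _ = 0F , inj₂ (refl , refl)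
  K₄⁻-edge 2F 0F _ = 1F , inj₂ (refl , refl)
  K₄⁻-edge 2F 1F _ = 2F , inj₂ (refl , refl)
  K₄⁻-edge 3F 0F _ = 3F , inj₂ (refl , refl)
  K₄⁻-edge 3F 1F _ = 4F , inj₂ (refl , refl)
  K₄⁻-edge 0F 0F (ne , _) = contradiction refl ne
  K₄⁻-edge 1F 1F (ne , _) = contradiction refl ne
  K₄⁻-edge 2F 2F (ne , _) = contradiction refl ne
  K₄⁻-edge 3F 3F (ne , _) = contradiction refl ne
  K₄⁻-edge 2F 3F (_ , ne) = contradiction (inj₁ (refl , refl)) ne
  K₄⁻-edge 3F 2F (_ , ne) = contradiction (inj₂ (refl , refl)) ne

  same-edge : ∀ {m} {u w x y p q : Fin m} → SameEdge u w p q → SameEdge x y p q → SameEdge u w x y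
  same-edge (inj₁ (refl , refl)) (inj₁ (refl , refl)) = inj₁ (refl , refl)
  same-edge (inj₁ (refl , refl)) (inj₂ (refl , refl)) = inj₂ (refl , refl)
  same-edge (inj₂ (refl , refl)) (inj₁ (refl , refl)) = inj₂ (refl , refl)
  same-edge (inj₂ (refl , refl)) (inj₂ (refl , refl)) = inj₁ (refl , refl)

  same-edge-colour : ∀ {m} (f : Fin m → Fin n) {u w p q} → SameEdge u w p q →
    colour c (f u) (f w) ≡ colour c (f p) (f q)
  same-edge-colour f (inj₁ (refl , refl)) = refl
  same-edge-colour f (inj₂ (refl , refl)) = colour-sym c _ _

  rainbow-from-edges : (f : Fin 4 → Fin n) → Injective _≡_ _≡_ f →
    Injective _≡_ _≡_ (λ e → colour c (f (proj₁ (K₄⁻-end e))) (f (proj₂ (K₄⁻-end e)))) →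
    HasRainbow K₄⁻ c
  rainbow-from-edges f f-inj c-inj = f , f-inj , λ u w x y uw xy e →
    let i , p = K₄⁻-edge u w uw
        j , q = K₄⁻-edge x y xy
        i≡j = c-inj {i} {j} (trans (sym (same-edge-colour f p)) (trans e (same-edge-colour f q)))
    in same-edge p (subst (λ e → SameEdge x y (proj₁ (K₄⁻-end e)) (proj₂ (K₄⁻-end e))) (sym i≡j) q)

  colouring-local : IsStarColouring c → ¬ HasRainbow K₄⁻ c → Local (colour c)
  colouring-local star ¬rainbow = record
    { symm     = colour-sym c
    ; disjoint = disj
    ; no-mono△ = no-mono
    ; pinched  = λ {a} {b} {x} {y} a≢b a≢x a≢y b≢x b≢y x≢y (p , q , r) (p′ , q′ , r′) →
        -- Of the ten pairs among five edges, the rainbow triangles separate six and disjointness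
        -- two; the last two are the coincidences claimed.
        decidable-stable (colour c a x ≟ colour c a y ⊎-dec colour c b x ≟ colour c b y) λ ne →
        ¬rainbow (rainbow-from-edges (a ∷ᶠ b ∷ᶠ x ∷ᶠ y ∷ᶠ []ᶠ)
          (∷-injective (λ { 0F → a≢b ; 1F → a≢x ; 2F → a≢y })
            (∷-injective (λ { 0F → b≢x ; 1F → b≢y }) (pair-injective x≢y)))
          (λ {i} {j} e → ∷-injective {h = colour c a x ∷ᶠ colour c b x ∷ᶠ colour c a y ∷ᶠ colour c b y ∷ᶠ []ᶠ}
            (λ { 0F → p ; 1F → q ; 2F → p′ ; 3F → q′ })
            (∷-injective (λ { 0F → r ; 1F → ne ∘ inj₁ ; 2F → disj a≢x b≢y a≢b a≢y (b≢x ∘ sym) x≢y })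
              (∷-injective (λ { 0F → disj b≢x a≢y (a≢b ∘ sym) b≢y (a≢x ∘ sym) x≢y ; 1F → ne ∘ inj₂ })
                (pair-injective r′)))
            {i} {j} (trans (listed i) (trans e (sym (listed j))))))
    }
    where
    listed : ∀ {a b x y} e →
      (colour c a b ∷ᶠ colour c a x ∷ᶠ colour c b x ∷ᶠ colour c a y ∷ᶠ colour c b y ∷ᶠ []ᶠ) e ≡
      colour c ((a ∷ᶠ b ∷ᶠ x ∷ᶠ y ∷ᶠ []ᶠ) (proj₁ (K₄⁻-end e))) ((a ∷ᶠ b ∷ᶠ x ∷ᶠ y ∷ᶠ []ᶠ) (proj₂ (K₄⁻-end e)))
    listed 0F = refl
    listed 1F = refl
    listed 2F = refl
    listed 3F = refl
    listed 4F = refl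
    disj : ∀ {a b x y} → a ≢ b → x ≢ y → a ≢ x → a ≢ y → b ≢ x → b ≢ y → colour c a b ≢ colour c x y
    disj a≢b x≢y a≢x a≢y b≢x b≢y e with class-centre star _
    ... | z , central with central a≢b refl | central x≢y (sym e)
    ...   | inj₁ refl | inj₁ refl = a≢x refl
    ...   | inj₁ refl | inj₂ refl = a≢y refl
    ...   | inj₂ refl | inj₁ refl = b≢x refl
    ...   | inj₂ refl | inj₂ refl = b≢y refl
    no-mono : ∀ {a b d} → a ≢ b → a ≢ d → b ≢ d → colour c a b ≡ colour c a d → colour c a b ≢ colour c b d
    no-mono a≢b a≢d b≢d e f with class-centre star _
    ... | z , central with central a≢b refl | central a≢d (sym e) | central b≢d (sym f)
    ...   | inj₁ refl | _         | inj₁ refl = a≢b refl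
    ...   | inj₁ refl | _         | inj₂ refl = a≢d refl
    ...   | inj₂ refl | inj₁ refl | _         = a≢b refl
    ...   | inj₂ refl | inj₂ refl | _         = b≢d refl

-- Naming colours and components block by block

Relation : ℕ → Set₁
Relation n = Fin n → Fin n → Set

-- The conditions of HasStructure for a colour matrix given in the order of the
-- positions, with an arbitrary graph E in place of J.
record Structured {n s} (E : Relation n) (d : Matrix n s) : Set where
  field
    component      : Fin n → ℕ
    component-spec : ∀ i j → component i ≡ component j ⇔ Star E i j
    name           : Fin s → ℕ ⊎ ℕ
    name-injective : ∀ {i j k l} → i ≢ j → k ≢ l → name (d i j) ≡ name (d k l) → d i j ≡ d k l
    name-positive  : ∀ {i j} → i ≢ j → name (d i j) ≢ inj₁ 0
    outside        : ∀ i j → i ≢ j → ¬ E i j → name (d i j) ≡ inj₁ (index i ⊓ index j)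
    inside         : ∀ i j → E i j → name (d i j) ≡ inj₂ (component i)

structured-cong : {E E′ : Relation n} {d : Matrix n s} →
  (∀ i j → E i j → E′ i j) → (∀ i j → E′ i j → E i j) → Structured E d → Structured E′ d
structured-cong to from st = record
  { component      = component
  ; component-spec = λ i j → mk⇔ (Star.map (to _ _) ∘ Equivalence.to (component-spec i j))
                                 (Equivalence.from (component-spec i j) ∘ Star.map (from _ _))
  ; name           = name
  ; name-injective = name-injective
  ; name-positive  = name-positive
  ; outside        = λ i j i≢j ¬e → outside i j i≢j (¬e ∘ to i j)
  ; inside         = λ i j e → inside i j (from i j e)
  }
  where open Structured st

structured-single : {E : Relation 1} {d : Matrix 1 s} → (∀ i j → ¬ E i j) → Structured E d
structured-single ¬E = record
  { component      = λ _ → 0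
  ; component-spec = λ { 0F 0F → mk⇔ (λ _ → ε) (λ _ → refl) }
  ; name           = λ _ → inj₁ 1
  ; name-injective = λ { {0F} {0F} ne _ _ → contradiction refl ne }
  ; name-positive  = λ _ ()
  ; outside        = λ { 0F 0F ne _ → contradiction refl ne }
  ; inside         = λ i j e → contradiction e (¬E i j)
  }

Adjacent : (Fin b → Fin b → Bool) → Relation b
Adjacent F i j = (i < j × T (F i j)) ⊎ (j < i × T (F j i))

BlockAdj : (Fin b → Fin b → Bool) → Relation n → Relation (b + n)
BlockAdj {b} {n} F E x y =
  (∃₂ λ i j → x ≡ i ↑ˡ n × y ≡ j ↑ˡ n × Adjacent F i j) ⊎
  (∃₂ λ i j → x ≡ b ↑ʳ i × y ≡ b ↑ʳ j × E i j)

-- The edges inside the block form one component, numbered 0.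
record OneComponent b (F : Fin b → Fin b → Bool) : Set where
  field
    0<b         : 0 ℕ.< b
    part        : Fin b → ℕ
    part<b      : ∀ i → part i ℕ.< b
    hub         : Fin b
    edge-part   : ∀ i j → Adjacent F i j → part i ≡ 0 × part j ≡ 0
    hub-reaches : ∀ i → part i ≡ 0 → i ≡ hub ⊎ Adjacent F hub i
    others      : ∀ i j → part i ≡ part j → i ≡ j ⊎ part i ≡ 0

  adjacent-sym : ∀ {i j} → Adjacent F i j → Adjacent F j i
  adjacent-sym = Sum.swap

  -- The edges inside a block form a star around `hub`, so two steps suffice.
  part⇒walk : ∀ {i j} → part i ≡ part j → Star (Adjacent F) i j
  part⇒walk {i} {j} e with others i j e
  ... | inj₁ refl = ε
  ... | inj₂ z with hub-reaches i z | hub-reaches j (trans (sym e) z)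
  ...   | inj₁ refl | inj₁ refl = ε
  ...   | inj₁ refl | inj₂ q    = q ◅ ε
  ...   | inj₂ p    | inj₁ refl = adjacent-sym p ◅ ε
  ...   | inj₂ p    | inj₂ q    = adjacent-sym p ◅ q ◅ ε

data View b {n} : Fin (b + n) → Set where
  inˡ : (i : Fin b) → View b (i ↑ˡ n)
  inʳ : (j : Fin n) → View b (b ↑ʳ j)

view : ∀ b {n} (x : Fin (b + n)) → View b x
view b {n} x = subst (View b) (join-splitAt b n x) (of-sum (splitAt b x))
  where
  of-sum : (s : Fin b ⊎ Fin n) → View b (join b n s)
  of-sum (inj₁ i) = inˡ i
  of-sum (inj₂ j) = inʳ j

↑ˡ≢↑ʳ : ∀ (i : Fin b) (j : Fin n) → i ↑ˡ n ≢ b ↑ʳ j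
↑ˡ≢↑ʳ {b} {n} i j e = <⇒≢ (≤-trans (toℕ<n i) (m≤m+n b (toℕ j)))
  (trans (sym (toℕ-↑ˡ i n)) (trans (cong toℕ e) (toℕ-↑ʳ b j)))

shift : ℕ → ℕ ⊎ ℕ → ℕ ⊎ ℕ
shift b = Sum.map (b +_) (b +_)

shift-injective : ∀ b {x y} → shift b x ≡ shift b y → x ≡ y
shift-injective b {inj₁ x} {inj₁ y} e = cong inj₁ (+-cancelˡ-≡ b x y (inj₁-injective e))
shift-injective b {inj₂ x} {inj₂ y} e = cong inj₂ (+-cancelˡ-≡ b x y (inj₂-injective e))

module BlockStructure {b n s : ℕ} {F : Fin b → Fin b → Bool} (oc : OneComponent b F)
  {d : Matrix (b + n) s} (l : Local d) (blk : IsBlock b F d)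
  {E : Relation n} (st : Structured E (dropBlock b d)) where
  open Local l
  open LocalTheory l
  open IsBlock blk
  open OneComponent oc
  private module Rest = Structured st

  -- An edge below the block with colour `γ i` would close a monochromatic triangle with the vertex
  -- `i`.
  γ-fresh : ∀ i {j k} → j ≢ k → d (b ↑ʳ j) (b ↑ʳ k) ≢ γ i
  γ-fresh i {j} {k} j≢k e = no-mono△ (↑ˡ≢↑ʳ i j) (↑ˡ≢↑ʳ i k) (j≢k ∘ ↑ʳ-injective b j k)
    (trans (cross i j) (sym (cross i k))) (trans (cross i j) (sym e))

  -- Numbers inside the block stay below `b`. The shift by `b` is the one `name` applies, which
  -- keeps names and components in step.
  component : Fin (b + n) → ℕ
  component x = [ part , (λ j → b + Rest.component j) ]′ (splitAt b x)

  component-ˡ : ∀ i → component (i ↑ˡ n) ≡ part i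
  component-ˡ i rewrite splitAt-↑ˡ b i n = refl

  component-ʳ : ∀ j → component (b ↑ʳ j) ≡ b + Rest.component j
  component-ʳ j rewrite splitAt-↑ʳ b n j = refl

  part≢shifted : ∀ i x → part i ≢ b + x
  part≢shifted i x = <⇒≢ (≤-trans (part<b i) (m≤m+n b x))

  component⇒walk : ∀ {x y} → View b x → View b y → component x ≡ component y → Star (BlockAdj F E) x y
  component⇒walk (inˡ i) (inˡ j) e =
    gmap (_↑ˡ n) (λ a → inj₁ (_ , _ , refl , refl , a))
      (part⇒walk (trans (sym (component-ˡ i)) (trans e (component-ˡ j))))
  component⇒walk (inˡ i) (inʳ j) e =
    contradiction (trans (sym (component-ˡ i)) (trans e (component-ʳ j))) (part≢shifted i _)
  component⇒walk (inʳ i) (inˡ j) e =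
    contradiction (trans (sym (component-ˡ j)) (trans (sym e) (component-ʳ i))) (part≢shifted j _)
  component⇒walk (inʳ i) (inʳ j) e =
    gmap (b ↑ʳ_) (λ a → inj₂ (_ , _ , refl , refl , a)) (Equivalence.to (Rest.component-spec i j)
      (+-cancelˡ-≡ b _ _ (trans (sym (component-ʳ i)) (trans e (component-ʳ j)))))

  edge⇒component : ∀ {x y} → BlockAdj F E x y → component x ≡ component y
  edge⇒component (inj₁ (i , j , refl , refl , a)) =
    let p , q = edge-part i j a in trans (component-ˡ i) (trans p (sym (trans (component-ˡ j) q)))
  edge⇒component (inj₂ (i , j , refl , refl , e)) =
    trans (component-ʳ i) (trans (cong (b +_) (Equivalence.from (Rest.component-spec i j) (e ◅ ε)))
      (sym (component-ʳ j)))

  -- The value 0 for `δ` is the component number of the edges inside the block.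
  name : Fin s → ℕ ⊎ ℕ
  name k with k ≟ δ | any? (λ i → k ≟ γ i)
  ... | yes _ | _           = inj₂ 0
  ... | no _  | yes (i , _) = inj₁ (index i)
  ... | no _  | no _        = shift b (Rest.name k)

  name-δ : name δ ≡ inj₂ 0
  name-δ with δ ≟ δ
  ... | yes _ = refl
  ... | no ne = contradiction refl ne

  name-γ : ∀ i → name (γ i) ≡ inj₁ (index i)
  name-γ i with γ i ≟ δ | any? (λ j → γ i ≟ γ j)
  ... | yes e | _           = contradiction e (γ≢δ i)
  ... | no _  | yes (j , e) = cong (inj₁ ∘ index) (sym (γ-injective e))
  ... | no _  | no ne       = contradiction (i , refl) ne

  name-rest : ∀ {i j} → i ≢ j → name (d (b ↑ʳ i) (b ↑ʳ j)) ≡ shift b (Rest.name (d (b ↑ʳ i) (b ↑ʳ j)))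
  name-rest {i} {j} i≢j with d (b ↑ʳ i) (b ↑ʳ j) ≟ δ | any? (λ k → d (b ↑ʳ i) (b ↑ʳ j) ≟ γ k)
  ... | yes e | _           = contradiction e (δ-fresh i j i≢j)
  ... | no _  | yes (k , e) = contradiction e (γ-fresh k i≢j)
  ... | no _  | no _        = refl

  -- Sorting colours by origin spares the injectivity proof a case analysis on four positions.
  data Colour : Fin s → Set where
    is-δ    : ∀ {k} → k ≡ δ → Colour k
    is-γ    : ∀ {k} i → k ≡ γ i → Colour k
    is-rest : ∀ {k} i j → i ≢ j → k ≡ d (b ↑ʳ i) (b ↑ʳ j) → Colour k

  inner-colour : ∀ {i j} → i < j → (T (F i j) × d (i ↑ˡ n) (j ↑ˡ n) ≡ δ) ⊎ (¬ T (F i j) × d (i ↑ˡ n) (j ↑ˡ n) ≡ γ i)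
  inner-colour {i} {j} i<j with F i j | inner i j i<j
  ... | true  | e = inj₁ (_ , e)
  ... | false | e = inj₂ ((λ ()) , e)

  classify< : ∀ {i j} → i < j → Colour (d (i ↑ˡ n) (j ↑ˡ n))
  classify< i<j with inner-colour i<j
  ... | inj₁ (_ , e) = is-δ e
  ... | inj₂ (_ , e) = is-γ _ e

  classify : ∀ {x y} → View b x → View b y → x ≢ y → Colour (d x y)
  classify (inˡ i) (inʳ j) _ = is-γ i (cross i j)
  classify (inʳ i) (inˡ j) _ = is-γ j (flipˡ (cross j i))
  classify (inʳ i) (inʳ j) x≢y = is-rest i j (x≢y ∘ cong (b ↑ʳ_)) refl
  classify (inˡ i) (inˡ j) x≢y with <-cmp i j
  ... | tri< i<j _ _ = classify< i<j
  ... | tri≈ _ refl _ = contradiction refl x≢y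
  ... | tri> _ _ j<i = subst Colour (symm _ _) (classify< j<i)

  -- An index in the block is at most `b`, with equality at its last vertex. So only a name 0 from
  -- below could clash, and `name-positive` excludes it.
  index≢shifted : ∀ (i : Fin b) x → inj₁ (index i) ≡ shift b x → x ≡ inj₁ 0
  index≢shifted i (inj₁ zero)    e = refl
  index≢shifted i (inj₁ (suc x)) e = contradiction
    (inj₁-injective (trans e (cong inj₁ (+-suc b x)))) (<⇒≢ (s≤s (≤-trans (toℕ<n i) (m≤m+n b x))))

  0≢shifted : ∀ x → inj₂ 0 ≢ shift b x
  0≢shifted (inj₂ x) e = contradiction (inj₂-injective e) (<⇒≢ (≤-trans 0<b (m≤m+n b x)))

  name-injective′ : ∀ {k k′} → Colour k → Colour k′ → name k ≡ name k′ → k ≡ k′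
  name-injective′ (is-δ refl) (is-δ refl) e = refl
  name-injective′ (is-δ refl) (is-γ i refl) e with () ← trans (sym name-δ) (trans e (name-γ i))
  name-injective′ (is-γ i refl) (is-δ refl) e with () ← trans (sym name-δ) (trans (sym e) (name-γ i))
  name-injective′ (is-δ refl) (is-rest i j i≢j refl) e =
    contradiction (trans (sym name-δ) (trans e (name-rest i≢j))) (0≢shifted (Rest.name (d (b ↑ʳ i) (b ↑ʳ j))))
  name-injective′ (is-rest i j i≢j refl) (is-δ refl) e =
    contradiction (trans (sym name-δ) (trans (sym e) (name-rest i≢j))) (0≢shifted (Rest.name (d (b ↑ʳ i) (b ↑ʳ j))))
  name-injective′ (is-γ i refl) (is-γ j refl) e =
    cong γ (toℕ-injective (ℕ.suc-injective (inj₁-injective (trans (sym (name-γ i)) (trans e (name-γ j))))))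
  name-injective′ (is-γ i refl) (is-rest j k j≢k refl) e =
    contradiction (index≢shifted i (Rest.name (d (b ↑ʳ j) (b ↑ʳ k))) (trans (sym (name-γ i)) (trans e (name-rest j≢k)))) (Rest.name-positive j≢k)
  name-injective′ (is-rest j k j≢k refl) (is-γ i refl) e =
    contradiction (index≢shifted i (Rest.name (d (b ↑ʳ j) (b ↑ʳ k))) (trans (sym (name-γ i)) (trans (sym e) (name-rest j≢k)))) (Rest.name-positive j≢k)
  name-injective′ (is-rest i j i≢j refl) (is-rest k m k≢m refl) e =
    Rest.name-injective i≢j k≢m (shift-injective b (trans (sym (name-rest i≢j)) (trans e (name-rest k≢m))))

  name-positive′ : ∀ {k} → Colour k → name k ≢ inj₁ 0
  name-positive′ (is-δ refl) e with () ← trans (sym name-δ) e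
  name-positive′ (is-γ i refl) e with () ← trans (sym (name-γ i)) e
  name-positive′ (is-rest i j i≢j refl) e = not-zero _ (Rest.name-positive i≢j) (trans (sym (name-rest i≢j)) e)
    where
    not-zero : ∀ x → x ≢ inj₁ 0 → shift b x ≢ inj₁ 0
    not-zero (inj₁ zero) ne _ = ne refl
    not-zero (inj₁ (suc x)) ne e with () ← trans (sym (cong inj₁ (+-suc b x))) e

  index-ˡ : ∀ (i : Fin b) → index (i ↑ˡ n) ≡ index i
  index-ˡ i = cong suc (toℕ-↑ˡ i n)

  index-ʳ : ∀ (j : Fin n) → index (b ↑ʳ j) ≡ b + index j
  index-ʳ j = trans (cong suc (toℕ-↑ʳ b j)) (sym (+-suc b (toℕ j)))

  min-ˡ : ∀ (i : Fin b) {y} → index i ≤ y → inj₁ (index i) ≡ inj₁ {B = ℕ} (index (i ↑ˡ n) ⊓ y)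
  min-ˡ i {y} le = cong inj₁ (sym (trans (cong (_⊓ y) (index-ˡ i)) (m≤n⇒m⊓n≡m le)))

  outside< : ∀ {i j} → i < j → ¬ BlockAdj F E (i ↑ˡ n) (j ↑ˡ n) →
    name (d (i ↑ˡ n) (j ↑ˡ n)) ≡ inj₁ (index (i ↑ˡ n) ⊓ index (j ↑ˡ n))
  outside< {i} {j} i<j ¬e with inner-colour i<j
  ... | inj₁ (t , _) = contradiction (inj₁ (i , j , refl , refl , inj₁ (i<j , t))) ¬e
  ... | inj₂ (_ , e) = trans (trans (cong name e) (name-γ i))
    (min-ˡ i (subst (index i ≤_) (sym (index-ˡ j)) (s≤s (<⇒≤ i<j))))

  outside-cross : ∀ i j → name (d (i ↑ˡ n) (b ↑ʳ j)) ≡ inj₁ (index (i ↑ˡ n) ⊓ index (b ↑ʳ j))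
  outside-cross i j = trans (trans (cong name (cross i j)) (name-γ i))
    (min-ˡ i (subst (index i ≤_) (sym (index-ʳ j)) (≤-trans (toℕ<n i) (m≤m+n b _))))

  outside-flip : ∀ {x y} → name (d x y) ≡ inj₁ (index x ⊓ index y) → name (d y x) ≡ inj₁ (index y ⊓ index x)
  outside-flip {x} {y} e = trans (cong name (symm y x)) (trans e (cong inj₁ (⊓-comm (index x) (index y))))

  blockAdj-sym-ˡ : ∀ {i j} → BlockAdj F E (i ↑ˡ n) (j ↑ˡ n) → BlockAdj F E (j ↑ˡ n) (i ↑ˡ n)
  blockAdj-sym-ˡ (inj₁ (i , j , p , q , a)) = inj₁ (j , i , q , p , Sum.swap a)
  blockAdj-sym-ˡ (inj₂ (i , j , p , q , _)) = contradiction p (↑ˡ≢↑ʳ _ i)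

  outside′ : ∀ {x y} → View b x → View b y → x ≢ y → ¬ BlockAdj F E x y →
    name (d x y) ≡ inj₁ (index x ⊓ index y)
  outside′ (inˡ i) (inʳ j) _ _ = outside-cross i j
  outside′ (inʳ i) (inˡ j) _ _ = outside-flip (outside-cross j i)
  outside′ (inʳ i) (inʳ j) x≢y ¬e = trans (name-rest i≢j) (trans
    (cong (shift b) (Rest.outside i j i≢j λ e → ¬e (inj₂ (i , j , refl , refl , e))))
    (cong inj₁ (trans (+-distribˡ-⊓ b _ _) (sym (cong₂ _⊓_ (index-ʳ i) (index-ʳ j))))))
    where
    i≢j : i ≢ j
    i≢j = x≢y ∘ cong (b ↑ʳ_)
  outside′ (inˡ i) (inˡ j) x≢y ¬e with <-cmp i j
  ... | tri< i<j _ _ = outside< i<j ¬e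
  ... | tri≈ _ refl _ = contradiction refl x≢y
  ... | tri> _ _ j<i = outside-flip (outside< j<i (¬e ∘ blockAdj-sym-ˡ))

  inside< : ∀ {i j} → i < j → T (F i j) → name (d (i ↑ˡ n) (j ↑ˡ n)) ≡ inj₂ 0
  inside< i<j t with inner-colour i<j
  ... | inj₁ (_ , e) = trans (cong name e) name-δ
  ... | inj₂ (¬t , _) = contradiction t ¬t

  inside′ : (∀ {i j} → E i j → i ≢ j) → ∀ {x y} → BlockAdj F E x y → name (d x y) ≡ inj₂ (component x)
  inside′ irr (inj₁ (i , j , refl , refl , a)) = trans (either a)
    (cong inj₂ (sym (trans (component-ˡ i) (proj₁ (edge-part i j a)))))
    where
    either : Adjacent F i j → name (d (i ↑ˡ n) (j ↑ˡ n)) ≡ inj₂ 0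
    either (inj₁ (i<j , t)) = inside< i<j t
    either (inj₂ (j<i , t)) = trans (cong name (symm _ _)) (inside< j<i t)
  inside′ irr (inj₂ (i , j , refl , refl , e)) = trans (name-rest (irr e)) (trans
    (cong (shift b) (Rest.inside i j e)) (cong inj₂ (sym (component-ʳ i))))

  structured-block : (∀ {i j} → E i j → i ≢ j) → Structured (BlockAdj F E) d
  structured-block irr = record
    { component      = component
    ; component-spec = λ i j → mk⇔ (component⇒walk (view b i) (view b j))
        (fold (λ x y → component x ≡ component y) (λ e → trans (edge⇒component e)) refl)
    ; name           = name
    ; name-injective = λ i≢j k≢l → name-injective′ (classify (view b _) (view b _) i≢j) (classify (view b _) (view b _) k≢l)
    ; name-positive  = λ i≢j → name-positive′ (classify (view b _) (view b _) i≢j)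
    ; outside        = λ i j → outside′ (view b i) (view b j)
    ; inside         = λ i j → inside′ irr
    }

pair-one-component : OneComponent 2 pairEdges
pair-one-component = record
  { 0<b         = s≤s z≤n
  ; part        = λ _ → 0
  ; part<b      = λ _ → s≤s z≤n
  ; hub         = 0F
  ; edge-part   = λ _ _ _ → refl , refl
  ; hub-reaches = λ { 0F _ → inj₁ refl ; 1F _ → inj₂ (inj₁ (s≤s z≤n , _)) }
  ; others      = λ _ _ _ → inj₂ refl
  }

adjacent? : (F : Fin b → Fin b → Bool) → ∀ i j → Dec (Adjacent F i j)
adjacent? F i j = (i <? j ×-dec T? (F i j)) ⊎-dec (j <? i ×-dec T? (F j i))

-- The last three fields of `OneComponent` in decidable form, so that each triple is settled by
-- evaluation.
IsHub : (Fin b → Fin b → Bool) → (Fin b → ℕ) → Fin b → Set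
IsHub F part hub =
  (∀ i j → Adjacent F i j → part i ≡ 0 × part j ≡ 0) ×
  (∀ i → part i ≡ 0 → i ≡ hub ⊎ Adjacent F hub i) ×
  (∀ i j → part i ≡ part j → i ≡ j ⊎ part i ≡ 0)

isHub? : (F : Fin b → Fin b → Bool) (part : Fin b → ℕ) (hub : Fin b) → Dec (IsHub F part hub)
isHub? F part hub =
  (all? λ i → all? λ j → adjacent? F i j →-dec (part i ℕ.≟ 0 ×-dec part j ℕ.≟ 0)) ×-dec
  (all? λ i → (part i ℕ.≟ 0) →-dec (i ≟ hub ⊎-dec adjacent? F hub i)) ×-dec
  (all? λ i → all? λ j → (part i ℕ.≟ part j) →-dec (i ≟ j ⊎-dec part i ℕ.≟ 0))

triple-one-component : ∀ t → OneComponent 3 (tripleEdges t)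
triple-one-component t = record
  { 0<b         = s≤s z≤n
  ; part        = part t
  ; part<b      = part<3 t
  ; hub         = hub t
  ; edge-part   = proj₁ (isHub t)
  ; hub-reaches = proj₁ (proj₂ (isHub t))
  ; others      = proj₂ (proj₂ (isHub t))
  }
  where
  part : Triple → Fin 3 → ℕ
  part ⟨01⟩    = 0 ∷ᶠ 0 ∷ᶠ 1 ∷ᶠ []ᶠ
  part ⟨02⟩    = 0 ∷ᶠ 1 ∷ᶠ 0 ∷ᶠ []ᶠ
  part ⟨12⟩    = 1 ∷ᶠ 0 ∷ᶠ 0 ∷ᶠ []ᶠ
  part ⟨01,02⟩ = 0 ∷ᶠ 0 ∷ᶠ 0 ∷ᶠ []ᶠ
  hub : Triple → Fin 3
  hub ⟨12⟩ = 1F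
  hub _    = 0F
  part<3 : ∀ t i → part t i ℕ.< 3
  part<3 ⟨01⟩    = from-yes (all? λ i → part ⟨01⟩ i ℕ.<? 3)
  part<3 ⟨02⟩    = from-yes (all? λ i → part ⟨02⟩ i ℕ.<? 3)
  part<3 ⟨12⟩    = from-yes (all? λ i → part ⟨12⟩ i ℕ.<? 3)
  part<3 ⟨01,02⟩ = from-yes (all? λ i → part ⟨01,02⟩ i ℕ.<? 3)
  isHub : ∀ t → IsHub (tripleEdges t) (part t) (hub t)
  isHub ⟨01⟩    = from-yes (isHub? (tripleEdges ⟨01⟩) (part ⟨01⟩) (hub ⟨01⟩))
  isHub ⟨02⟩    = from-yes (isHub? (tripleEdges ⟨02⟩) (part ⟨02⟩) (hub ⟨02⟩))
  isHub ⟨12⟩    = from-yes (isHub? (tripleEdges ⟨12⟩) (part ⟨12⟩) (hub ⟨12⟩))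
  isHub ⟨01,02⟩ = from-yes (isHub? (tripleEdges ⟨01,02⟩) (part ⟨01,02⟩) (hub ⟨01,02⟩))

-- The graph J

On : (ℕ → ℕ → Set) → Relation n
On R i j = R (toℕ i) (toℕ j) ⊎ R (toℕ j) (toℕ i)

-- On natural numbers, putting a block on top is a mere shift, with no transport between finite
-- types.
Prepend : ∀ b → (Fin b → Fin b → Bool) → (ℕ → ℕ → Set) → ℕ → ℕ → Set
Prepend b F R x y =
  (∃₂ λ (i j : Fin b) → i < j × T (F i j) × x ≡ toℕ i × y ≡ toℕ j) ⊎
  (∃₂ λ x′ y′ → x ≡ b + x′ × y ≡ b + y′ × R x′ y′)

module _ {b n : ℕ} {F : Fin b → Fin b → Bool} {R : ℕ → ℕ → Set} where

  blockAdj⇒on : ∀ (x y : Fin (b + n)) → BlockAdj F (On R) x y → On (Prepend b F R) x y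
  blockAdj⇒on _ _ (inj₁ (i , j , refl , refl , a)) = Sum.map edge edge a
    where
    edge : ∀ {i j} → i < j × T (F i j) → Prepend b F R (toℕ (i ↑ˡ n)) (toℕ (j ↑ˡ n))
    edge (lt , t) = inj₁ (_ , _ , lt , t , toℕ-↑ˡ _ n , toℕ-↑ˡ _ n)
  blockAdj⇒on _ _ (inj₂ (i , j , refl , refl , e)) = Sum.map edge edge e
    where
    edge : ∀ {i j : Fin n} → R (toℕ i) (toℕ j) → Prepend b F R (toℕ (b ↑ʳ i)) (toℕ (b ↑ʳ j))
    edge r = inj₂ (_ , _ , toℕ-↑ʳ b _ , toℕ-↑ʳ b _ , r)

  on⇒blockAdj : ∀ (x y : Fin (b + n)) → On (Prepend b F R) x y → BlockAdj F (On R) x y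
  on⇒blockAdj x y = λ { (inj₁ p) → edge x y p ; (inj₂ p) → flip (edge y x p) }
    where
    flip : ∀ {x y} → BlockAdj {n = n} F (On R) x y → BlockAdj F (On R) y x
    flip (inj₁ (i , j , p , q , a)) = inj₁ (j , i , q , p , Sum.swap a)
    flip (inj₂ (i , j , p , q , e)) = inj₂ (j , i , q , p , Sum.swap e)
    left : ∀ {x : Fin (b + n)} {i : Fin b} → toℕ x ≡ toℕ i → x ≡ i ↑ˡ n
    left e = toℕ-injective (trans e (sym (toℕ-↑ˡ _ n)))
    right : ∀ {x} → View b {n} x → ∀ {x′} → toℕ x ≡ b + x′ → ∃ λ i → x ≡ b ↑ʳ i × toℕ i ≡ x′
    right (inˡ i) e = contradiction (trans (sym (toℕ-↑ˡ i n)) e) (<⇒≢ (≤-trans (toℕ<n i) (m≤m+n b _)))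
    right (inʳ i) e = i , refl , +-cancelˡ-≡ b _ _ (trans (sym (toℕ-↑ʳ b i)) e)
    edge : ∀ x y → Prepend b F R (toℕ x) (toℕ y) → BlockAdj F (On R) x y
    edge x y (inj₁ (i , j , lt , t , p , q)) = inj₁ (i , j , left p , left q , inj₁ (lt , t))
    edge x y (inj₂ (x′ , y′ , p , q , r)) with right (view b x) p | right (view b y) q
    ... | i , refl , refl | j , refl , refl = inj₂ (i , j , refl , refl , inj₁ r)

on-map : {R R′ : ℕ → ℕ → Set} → (∀ x y → R x y → R′ x y) → ∀ (i j : Fin n) → On R i j → On R′ i j
on-map f i j = Sum.map (f _ _) (f _ _)

Increasing : (ℕ → ℕ → Set) → Set
Increasing R = ∀ {x y} → R x y → x ℕ.< y

on-irrefl : {R : ℕ → ℕ → Set} → Increasing R → ∀ {i j : Fin n} → On R i j → i ≢ j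
on-irrefl inc (inj₁ r) refl = <⇒≢ (inc r) refl
on-irrefl inc (inj₂ r) refl = <⇒≢ (inc r) refl

structured-prepend : {F : Fin b → Fin b → Bool} {R R′ : ℕ → ℕ → Set} {d : Matrix (b + n) s} → OneComponent b F →
  Increasing R → (∀ {x y} → Prepend b F R x y → R′ x y) → (∀ {x y} → R′ x y → Prepend b F R x y) →
  Local d → IsBlock b F d → Structured (On R) (dropBlock b d) → Structured (On R′) d
structured-prepend oc inc to from l blk st = structured-cong
  (λ i j → on-map (λ x y → to {x} {y}) i j ∘ blockAdj⇒on i j) (λ i j → on⇒blockAdj i j ∘ on-map (λ x y → from {x} {y}) i j)
  (BlockStructure.structured-block oc l blk st (on-irrefl inc))

-- The edges of J with 0-based positions; 1 + M is half the number of vertices and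
-- 1 + a the parameter called a in Shape.
OddEdges : ℕ → ℕ → ℕ → Set
OddEdges m x y = ∃ λ r → r ℕ.< m × x ≡ 2 * r × y ≡ suc (2 * r)

EvenEdges : ℕ → ℕ → Triple → ℕ → ℕ → Set
EvenEdges a M t x y =
  OddEdges a x y ⊎
  (∃₂ λ i j → i < j × T (tripleEdges t i j) × x ≡ 2 * a + toℕ i × y ≡ 2 * a + toℕ j) ⊎
  (∃ λ r → a ℕ.< r × r ℕ.< M × x ≡ suc (2 * r) × y ≡ suc (suc (2 * r)))

oddEdges-increasing : ∀ {m} → Increasing (OddEdges m)
oddEdges-increasing (_ , _ , refl , refl) = n<1+n _

evenEdges-increasing : ∀ {a M t} → Increasing (EvenEdges a M t)
evenEdges-increasing (inj₁ e) = oddEdges-increasing e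
evenEdges-increasing {a} (inj₂ (inj₁ (_ , _ , lt , _ , refl , refl))) = +-monoʳ-< (2 * a) lt
evenEdges-increasing (inj₂ (inj₂ (_ , _ , _ , refl , refl))) = n<1+n _

oddEdges-suc : ∀ {m x y} → Prepend 2 pairEdges (OddEdges m) x y → OddEdges (suc m) x y
oddEdges-suc (inj₁ (0F , 1F , _ , _ , refl , refl)) = 0 , s≤s z≤n , refl , refl
oddEdges-suc (inj₁ (1F , 1F , s≤s () , _))
oddEdges-suc (inj₂ (_ , _ , refl , refl , r , lt , refl , refl)) =
  suc r , s≤s lt , sym (*-suc 2 r) , cong suc (sym (*-suc 2 r))

oddEdges-suc⁻¹ : ∀ {m x y} → OddEdges (suc m) x y → Prepend 2 pairEdges (OddEdges m) x y
oddEdges-suc⁻¹ (zero , _ , refl , refl) = inj₁ (0F , 1F , s≤s z≤n , _ , refl , refl)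
oddEdges-suc⁻¹ (suc r , s≤s lt , refl , refl) =
  inj₂ (_ , _ , *-suc 2 r , cong suc (*-suc 2 r) , r , lt , refl , refl)

evenEdges-suc : ∀ {a M t x y} → Prepend 2 pairEdges (EvenEdges a M t) x y → EvenEdges (suc a) (suc M) t x y
evenEdges-suc (inj₁ e) = inj₁ (oddEdges-suc (inj₁ e))
evenEdges-suc (inj₂ (_ , _ , p , q , inj₁ e)) = inj₁ (oddEdges-suc (inj₂ (_ , _ , p , q , e)))
evenEdges-suc {a} (inj₂ (_ , _ , refl , refl , inj₂ (inj₁ (i , j , lt , t , refl , refl)))) =
  inj₂ (inj₁ (i , j , lt , t , cong (_+ toℕ i) (sym (*-suc 2 a)) , cong (_+ toℕ j) (sym (*-suc 2 a))))
evenEdges-suc (inj₂ (_ , _ , refl , refl , inj₂ (inj₂ (r , lo , hi , refl , refl)))) =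
  inj₂ (inj₂ (suc r , s≤s lo , s≤s hi , cong suc (sym (*-suc 2 r)) , cong (2 +_) (sym (*-suc 2 r))))

evenEdges-suc⁻¹ : ∀ {a M t x y} → EvenEdges (suc a) (suc M) t x y → Prepend 2 pairEdges (EvenEdges a M t) x y
evenEdges-suc⁻¹ (inj₁ e) with oddEdges-suc⁻¹ e
... | inj₁ e′ = inj₁ e′
... | inj₂ (_ , _ , p , q , e′) = inj₂ (_ , _ , p , q , inj₁ e′)
evenEdges-suc⁻¹ {a} (inj₂ (inj₁ (i , j , lt , t , refl , refl))) =
  inj₂ (_ , _ , cong (_+ toℕ i) (*-suc 2 a) , cong (_+ toℕ j) (*-suc 2 a) , inj₂ (inj₁ (i , j , lt , t , refl , refl)))
evenEdges-suc⁻¹ (inj₂ (inj₂ (suc r , s≤s lo , s≤s hi , refl , refl))) =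
  inj₂ (_ , _ , cong suc (*-suc 2 r) , cong (2 +_) (*-suc 2 r) , inj₂ (inj₂ (r , lo , hi , refl , refl)))

-- Three positions in front move a pair from `2 * r` to `3 + 2 * r`; this is why the pairs below the
-- triangle start at odd positions.
evenEdges-zero : ∀ {m t x y} → Prepend 3 (tripleEdges t) (OddEdges m) x y → EvenEdges 0 (suc m) t x y
evenEdges-zero (inj₁ e) = inj₂ (inj₁ e)
evenEdges-zero (inj₂ (_ , _ , refl , refl , r , lt , refl , refl)) =
  inj₂ (inj₂ (suc r , s≤s z≤n , s≤s lt , cong suc (sym (*-suc 2 r)) , cong (2 +_) (sym (*-suc 2 r))))

evenEdges-zero⁻¹ : ∀ {m t x y} → EvenEdges 0 (suc m) t x y → Prepend 3 (tripleEdges t) (OddEdges m) x y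
evenEdges-zero⁻¹ (inj₂ (inj₁ e)) = inj₁ e
evenEdges-zero⁻¹ (inj₂ (inj₂ (suc r , _ , s≤s lt , refl , refl))) =
  inj₂ (_ , _ , cong suc (*-suc 2 r) , cong (2 +_) (*-suc 2 r) , r , lt , refl , refl)

↑ʳ-local : ∀ b {d : Matrix (b + n) s} → Local d → Local (dropBlock b d)
↑ʳ-local b l = local-restrict l (↑ʳ-injective b _ _)

oddTower-structured : ∀ {o : Odd n} {d : Matrix n s} → OddTower o d → Local d →
  ∃ λ m → n ≡ 2 * m + 1 × Structured (On (OddEdges m)) d
oddTower-structured single l = 0 , refl , structured-single λ { _ _ (inj₁ (_ , () , _)) ; _ _ (inj₂ (_ , () , _)) }
oddTower-structured (pair blk t) l =
  let m , p , st = oddTower-structured t (↑ʳ-local 2 l) in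
  suc m , trans (cong (2 +_) p) (cong (_+ 1) (sym (*-suc 2 m))) ,
  structured-prepend pair-one-component oddEdges-increasing oddEdges-suc oddEdges-suc⁻¹ l blk st

evenTower-structured : ∀ {d : Matrix n s} → EvenTower d → Local d →
  ∃ λ M → ∃₂ λ a t → n ≡ 2 * suc M × a ℕ.< M × Structured (On (EvenEdges a M t)) d
evenTower-structured (triple t blk tower) l =
  let m , p , st = oddTower-structured tower (↑ʳ-local 3 l) in
  suc m , 0 , t ,
  trans (cong (3 +_) (trans p (+-comm (2 * m) 1))) (trans (cong (2 +_) (sym (*-suc 2 m))) (sym (*-suc 2 (suc m)))) ,
  s≤s z≤n ,
  structured-prepend (triple-one-component t) oddEdges-increasing evenEdges-zero evenEdges-zero⁻¹ l blk st
evenTower-structured (pair blk tower) l =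
  let M , a , t , p , lt , st = evenTower-structured tower (↑ʳ-local 2 l) in
  suc M , suc a , t , trans (cong (2 +_) p) (sym (*-suc 2 (suc M))) , s≤s lt ,
  structured-prepend pair-one-component (evenEdges-increasing {a} {M} {t}) evenEdges-suc evenEdges-suc⁻¹ l blk st

-- Comparison with the 1-based edge lists

2*suc∸1 : ∀ r → 2 * suc r ∸ 1 ≡ suc (2 * r)
2*suc∸1 r = cong (_∸ 1) (*-suc 2 r)

infix 4 _≡²_
_≡²_ : ℕ × ℕ → ℕ × ℕ → Set
_≡²_ = _≡_

pair-≡ : ∀ {x x′ y y′} → x ≡ x′ → y ≡ y′ → (x , y) ≡² (x′ , y′)
pair-≡ refl refl = refl

sucs-injective : ∀ {x y x′ y′} → (suc x , suc y) ≡² (suc x′ , suc y′) → x ≡ x′ × y ≡ y′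
sucs-injective refl = refl , refl

odd-listed : ∀ {m x y} → (∃ λ t → 1 ≤ t × t ≤ m × (suc x , suc y) ≡² (2 * t ∸ 1 , 2 * t)) ⇔ OddEdges m x y
odd-listed = mk⇔
  (λ { (suc r , _ , lt , e) → let p , q = sucs-injective (trans e (pair-≡ (2*suc∸1 r) (*-suc 2 r))) in r , lt , p , q })
  (λ { (r , lt , refl , refl) → suc r , s≤s z≤n , lt , sym (pair-≡ (2*suc∸1 r) (*-suc 2 r)) })

tripleSubset : Triple → Subset 3
tripleSubset ⟨01⟩    = true ∷ false ∷ false ∷ []
tripleSubset ⟨02⟩    = false ∷ true ∷ false ∷ []
tripleSubset ⟨12⟩    = false ∷ false ∷ true ∷ []
tripleSubset ⟨01,02⟩ = true ∷ true ∷ false ∷ []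

tripleSubset-size : ∀ t → 1 ≤ ∣ tripleSubset t ∣ × ∣ tripleSubset t ∣ ≤ 2
tripleSubset-size ⟨01⟩    = s≤s z≤n , s≤s z≤n
tripleSubset-size ⟨02⟩    = s≤s z≤n , s≤s z≤n
tripleSubset-size ⟨12⟩    = s≤s z≤n , s≤s z≤n
tripleSubset-size ⟨01,02⟩ = s≤s z≤n , s≤s (s≤s z≤n)

-- The end points of the edges of a triangle in the numbering of triangleEdge.
ends : Fin 3 → Fin 3 × Fin 3
ends 0F = 0F , 1F
ends 1F = 0F , 2F
ends 2F = 1F , 2F

triangleEdge-suc : ∀ a e → triangleEdge (suc a) e ≡
  (suc (2 * a + toℕ (proj₁ (ends e))) , suc (2 * a + toℕ (proj₂ (ends e))))
triangleEdge-suc a 0F = pair-≡ (trans (2*suc∸1 a) (cong suc (sym (ℕ.+-identityʳ _))))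
  (trans (*-suc 2 a) (cong suc (+-comm 1 (2 * a))))
triangleEdge-suc a 1F = pair-≡ (trans (2*suc∸1 a) (cong suc (sym (ℕ.+-identityʳ _))))
  (trans (cong (_+ 1) (*-suc 2 a)) (cong suc (trans (cong suc (+-comm (2 * a) 1)) (+-comm 2 (2 * a)))))
triangleEdge-suc a 2F = pair-≡ (trans (*-suc 2 a) (cong suc (+-comm 1 (2 * a))))
  (trans (cong (_+ 1) (*-suc 2 a)) (cong suc (trans (cong suc (+-comm (2 * a) 1)) (+-comm 2 (2 * a)))))

subset-edge : ∀ t e → e ∈ tripleSubset t →
  proj₁ (ends e) < proj₂ (ends e) × T (tripleEdges t (proj₁ (ends e)) (proj₂ (ends e)))
subset-edge ⟨01⟩    _ here                         = s≤s z≤n , _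
subset-edge ⟨01⟩    _ (there (there (there ())))
subset-edge ⟨02⟩    _ (there here)                 = s≤s z≤n , _
subset-edge ⟨02⟩    _ (there (there (there ())))
subset-edge ⟨12⟩    _ (there (there here))         = s≤s (s≤s z≤n) , _
subset-edge ⟨01,02⟩ _ here                         = s≤s z≤n , _
subset-edge ⟨01,02⟩ _ (there here)                 = s≤s z≤n , _
subset-edge ⟨01,02⟩ _ (there (there (there ())))

edge-subset : ∀ t i j → i < j → T (tripleEdges t i j) → ∃ λ e → e ∈ tripleSubset t × ends e ≡ (i , j)
edge-subset ⟨01⟩    0F 1F _ _ = 0F , here , refl
edge-subset ⟨02⟩    0F 2F _ _ = 1F , there here , refl
edge-subset ⟨12⟩    1F 2F _ _ = 2F , there (there here) , refl
edge-subset ⟨01,02⟩ 0F 1F _ _ = 0F , here , refl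
edge-subset ⟨01,02⟩ 0F 2F _ _ = 1F , there here , refl
edge-subset ⟨01⟩    0F 2F _ ()
edge-subset ⟨01⟩    1F 2F _ ()
edge-subset ⟨02⟩    0F 1F _ ()
edge-subset ⟨02⟩    1F 2F _ ()
edge-subset ⟨12⟩    0F 1F _ ()
edge-subset ⟨12⟩    0F 2F _ ()
edge-subset ⟨01,02⟩ 1F 2F _ ()
edge-subset _ _ 0F () _
edge-subset _ 1F 1F (s≤s ()) _
edge-subset _ 2F 1F (s≤s ()) _
edge-subset _ 2F 2F (s≤s (s≤s ())) _

triangle-listed : ∀ {a t x y} → (∃ λ e → e ∈ tripleSubset t × (suc x , suc y) ≡² triangleEdge (suc a) e) ⇔
  (∃₂ λ i j → i < j × T (tripleEdges t i j) × x ≡ 2 * a + toℕ i × y ≡ 2 * a + toℕ j)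
triangle-listed {a} {t} = mk⇔
  (λ { (e , e∈ , q) → let lt , tr = subset-edge t e e∈
                          p , r = sucs-injective (trans q (triangleEdge-suc a e)) in _ , _ , lt , tr , p , r })
  (λ { (i , j , lt , tr , refl , refl) → let e , e∈ , q = edge-subset t i j lt tr in
       e , e∈ , sym (trans (triangleEdge-suc a e)
                      (cong (λ (i , j) → suc (2 * a + toℕ i) , suc (2 * a + toℕ j)) q)) })

-- The parameters in `Shape` are `suc a` and `suc M`; with `t` equal to `suc r` the range of `t`
-- becomes `a < r < M`.
last-listed : ∀ {a M x y} → (∃ λ t → suc a + 1 ≤ t × t ≤ M × (suc x , suc y) ≡² (2 * t , 2 * t + 1)) ⇔
  (∃ λ r → a ℕ.< r × r ℕ.< M × x ≡ suc (2 * r) × y ≡ suc (suc (2 * r)))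
last-listed {a} = mk⇔
  (λ { (suc r , s≤s lo , hi , e) →
         let p , q = sucs-injective (trans e (pair-≡ (*-suc 2 r) (2*suc+1 r))) in
         r , subst (_≤ r) (+-comm a 1) lo , hi , p , q })
  (λ { (r , lo , hi , refl , refl) →
         suc r , s≤s (subst (_≤ r) (+-comm 1 a) lo) , hi , sym (pair-≡ (*-suc 2 r) (2*suc+1 r)) })
  where
  2*suc+1 : ∀ r → 2 * suc r + 1 ≡ 3 + 2 * r
  2*suc+1 r = trans (+-comm _ 1) (cong suc (*-suc 2 r))

evenShape : ∀ M a → Triple → n ≡ 2 * suc M → a ℕ.< M → Shape n
evenShape {n} M a t p lt = even (suc M) p
  (subst (4 ≤_) (sym p) (*-monoʳ-≤ 2 (s≤s (≤-trans (s≤s z≤n) lt))))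
  (suc a) (subst (3 ≤_) (+-comm 1 (2 * suc a)) (s≤s (*-monoʳ-≤ 2 (s≤s {n = a} z≤n))))
  (subst (λ n → 2 * suc a + 1 ≤ n ∸ 1) (sym (trans p (*-suc 2 M)))
    (subst (_≤ suc (2 * M)) (+-comm 1 (2 * suc a)) (s≤s (*-monoʳ-≤ 2 lt))))
  (tripleSubset t) (proj₁ (tripleSubset-size t)) (proj₂ (tripleSubset-size t))

J⇔On : (σ : Shape n) {R : ℕ → ℕ → Set} → Increasing R → (∀ {x y} → Listed σ (suc x) (suc y) ⇔ R x y) →
  ∀ i j → Adj (J σ) i j ⇔ On R i j
J⇔On σ inc h i j = mk⇔
  (λ (_ , e) → Sum.map (Equivalence.to h) (Equivalence.to h) e)
  (λ e → on-irrefl inc e , Sum.map (Equivalence.from h) (Equivalence.from h) e)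

listed-odd : ∀ m (p : n ≡ 2 * m + 1) → ∀ {x y} → Listed (odd m p) (suc x) (suc y) ⇔ OddEdges m x y
listed-odd m p = odd-listed

listed-even : ∀ M a t (p : n ≡ 2 * suc M) lt → ∀ {x y} →
  Listed (evenShape M a t p lt) (suc x) (suc y) ⇔ EvenEdges a M t x y
listed-even M a t p lt = mk⇔
  (Sum.map (Equivalence.to odd-listed) (Sum.map (Equivalence.to (triangle-listed {a} {t})) (Equivalence.to last-listed)))
  (Sum.map (Equivalence.from odd-listed) (Sum.map (Equivalence.from (triangle-listed {a} {t})) (Equivalence.from last-listed)))

hasStructure : (c : Colouring n s) {f : Fin n → Fin n} → Injective _≡_ _≡_ f → (σ : Shape n) →
  {R : ℕ → ℕ → Set} → Increasing R → (∀ {x y} → Listed σ (suc x) (suc y) ⇔ R x y) →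
  Structured (On R) (restrict (colour c) f) → HasStructure c
hasStructure {n} {s} c {f} inj σ inc h st = record
  { ordering         = Permutation.permutation f (proj₁ ∘ onto) (proj₂ ∘ onto) (λ x → inj (proj₂ (onto (f x))))
  ; shape            = σ
  ; component        = component
  ; component-spec   = component-spec
  ; rename           = name
  -- Names separate only the colours of edges, so each colour is first traced to an edge that
  -- carries it.
  ; rename-injective = λ {k} {k′} → same-name (all-used c k) (all-used c k′)
  ; outside-J        = outside
  ; inside-J         = inside
  }
  where
  open Structured (structured-cong (λ i j → Equivalence.from (J⇔On σ inc h i j))
                                   (λ i j → Equivalence.to (J⇔On σ inc h i j)) st)
  onto = injective⇒surjective inj
  same-name : ∀ {k k′} → (∃₂ λ i j → i ≢ j × colour c i j ≡ k) → (∃₂ λ i j → i ≢ j × colour c i j ≡ k′) →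
    name k ≡ name k′ → k ≡ k′
  same-name (i , j , i≢j , refl) (i′ , j′ , i′≢j′ , refl) e
    with a , refl ← onto i | b , refl ← onto j | a′ , refl ← onto i′ | b′ , refl ← onto j′
    = name-injective (i≢j ∘ cong f) (i′≢j′ ∘ cong f) e

hasStructure-two : (c : Colouring 2 1) → HasStructure c
hasStructure-two c = record
  { ordering         = Permutation.id
  ; shape            = two refl
  ; component        = toℕ
  ; component-spec   = λ i j → mk⇔ (λ e → subst (Star _ i) (toℕ-injective e) ε)
                                   (fold (λ i j → toℕ i ≡ toℕ j) (λ { (_ , inj₁ ()) ; (_ , inj₂ ()) }) refl)
  ; rename           = λ _ → inj₁ 1
  ; rename-injective = λ { {0F} {0F} _ → refl }
  ; outside-J        = λ { 0F 0F ne _ → contradiction refl ne ; 0F 1F _ _ → refl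
                         ; 1F 0F _ _ → refl ; 1F 1F ne _ → contradiction refl ne }
  ; inside-J         = λ { _ _ (_ , inj₁ ()) ; _ _ (_ , inj₂ ()) }
  }

-- The upper bound and the extremal structure

bound-formula : ∀ n → bound (suc n) ≡ 3 * n / 2
bound-formula 0 = refl
bound-formula 1 = refl
bound-formula (suc (suc n)) = begin
  3 + bound (suc n)   ≡⟨ cong (3 +_) (bound-formula n) ⟩
  3 + 3 * n / 2       ≡⟨ +-distrib-/-∣ˡ {6} (3 * n) {2} (divides 3 refl) ⟨
  (6 + 3 * n) / 2     ≡⟨ cong (_/ 2) (*-distribˡ-+ 3 2 n) ⟨
  3 * (2 + n) / 2     ∎
  where open ≡-Reasoning

module _ {n s : ℕ} (c : Colouring (suc n) s) (l : Local (colour c)) where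

  all-colours-used : All.All (Used (colour c)) (allFin s)
  all-colours-used = All.tabulate λ {k} _ → all-used c k

  upper-bound : s ≤ bound (suc n)
  upper-bound = subst (_≤ bound (suc n)) (length-tabulate {n = s} id)
    (colour-bound n (colour c) l (Unique.allFin⁺ s) all-colours-used)

odd-structure : (c : Colouring (suc n) s) → Local (colour c) → OddOrdering (colour c) → HasStructure c
odd-structure c l (o , g , inj , t) =
  let m , p , st = oddTower-structured t (local-restrict l inj)
  in hasStructure c inj (odd m p) oddEdges-increasing (listed-odd m p) st

even-structure : (c : Colouring n s) → Local (colour c) → Extension (colour c) id → HasStructure c
even-structure c l record { vertices = g ; injective = inj ; tower = tower } =
  let M , a , t , p , lt , st = evenTower-structured tower (local-restrict l inj)
  in hasStructure c inj (evenShape M a t p lt) (evenEdges-increasing {a} {M} {t}) (listed-even M a t p lt) st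

extremal-structure : ∀ n (c : Colouring (2 + n) s) → bound (2 + n) ≡ s → Local (colour c) → HasStructure c
-- Two vertices stand apart: deleting one leaves a tower without a pair, to which `readd` does not
-- apply.
extremal-structure zero c refl l = hasStructure-two c
extremal-structure {s} (suc n) c e l = by-parity (odd-or-suc-odd (2 + n))
  where
  unique = Unique.allFin⁺ s
  large = ≤-reflexive (trans e (sym (length-tabulate {n = s} id)))
  by-parity : Odd (2 + n) ⊎ Odd (3 + n) → HasStructure c
  by-parity (inj₁ o) = even-structure c l (extremal-even l o (s≤s z≤n) unique (all-colours-used c l) large)
  by-parity (inj₂ o) = odd-structure c l (odd-tower _ (colour c) l (extremal-odd l o unique (all-colours-used c l) large))

-- An extremal colouring

isStar : (c : Colouring n s) {k : Fin s} (z : Fin n) (g : Fin m → Fin n) → 1 ≤ m →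
  (∀ w → z ≢ g w) → Injective _≡_ _≡_ g → (∀ w → colour c z (g w) ≡ k) →
  (∀ i j → i ≢ j → colour c i j ≡ k → (i ≡ z × ∃ λ w → g w ≡ j) ⊎ (j ≡ z × ∃ λ w → g w ≡ i)) →
  IsStar (colourClass c k)
isStar {m = m} c {k} z g 1≤m z∉ inj coloured only = m , 1≤m , z ∷ᶠ g , ∷-injective z∉ inj ,
  λ i j → mk⇔ (λ (i≢j , e) → edge (only i j i≢j e)) back
  where
  edge : ∀ {i j} → (i ≡ z × ∃ λ w → g w ≡ j) ⊎ (j ≡ z × ∃ λ w → g w ≡ i) →
    ∃₂ λ u w → Adj (K₁, m) u w × (z ∷ᶠ g) u ≡ i × (z ∷ᶠ g) w ≡ j
  edge (inj₁ (refl , w , refl)) = zero , suc w , inj₁ (refl , λ ()) , refl , refl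
  edge (inj₂ (refl , w , refl)) = suc w , zero , inj₂ ((λ ()) , refl) , refl , refl
  back : ∀ {i j} → (∃₂ λ u w → Adj (K₁, m) u w × (z ∷ᶠ g) u ≡ i × (z ∷ᶠ g) w ≡ j) →
    i ≢ j × colour c i j ≡ k
  back (zero , zero , inj₁ (_ , ne) , _) = contradiction refl ne
  back (zero , zero , inj₂ (ne , _) , _) = contradiction refl ne
  back (zero , suc w , _ , refl , refl) = z∉ w , coloured w
  back (suc w , zero , _ , refl , refl) = z∉ w ∘ sym , trans (colour-sym c _ _) (coloured w)
  back (suc _ , suc _ , inj₁ (() , _) , _)
  back (suc _ , suc _ , inj₂ (_ , ()) , _)

edgeColouring : Colouring 2 1
edgeColouring = record
  { colour     = λ _ _ → 0F
  ; colour-sym = λ _ _ → refl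
  ; all-used   = λ { 0F → 0F , 1F , (λ ()) , refl }
  }

no-rainbow-small : (c : Colouring n s) → n ℕ.< 4 → ¬ HasRainbow K₄⁻ c
no-rainbow-small c n<4 (f , inj , _) = ℕ.<⇒≱ n<4 (injective⇒≤ inj)

edgeColouring-good : GoodColouring K₄⁻ edgeColouring
edgeColouring-good = (λ { 0F → isStar edgeColouring 0F (λ _ → 1F) (s≤s (z≤n {0})) (λ _ ()) (λ { {0F} {0F} _ → refl })
    (λ _ → refl) λ { 0F 0F ne _ → contradiction refl ne ; 0F 1F _ _ → inj₁ (refl , 0F , refl)
                   ; 1F 0F _ _ → inj₂ (refl , 0F , refl) ; 1F 1F ne _ → contradiction refl ne } }) ,
  no-rainbow-small edgeColouring (s≤s (s≤s (s≤s z≤n)))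

triangleColouring : Colouring 3 3
triangleColouring = record
  { colour     = col
  ; colour-sym = λ { 0F 0F → refl ; 0F 1F → refl ; 0F 2F → refl ; 1F 0F → refl ; 1F 1F → refl
                   ; 1F 2F → refl ; 2F 0F → refl ; 2F 1F → refl ; 2F 2F → refl }
  ; all-used   = λ { 0F → 0F , 1F , (λ ()) , refl ; 1F → 0F , 2F , (λ ()) , refl ; 2F → 1F , 2F , (λ ()) , refl }
  }
  where
  col : Fin 3 → Fin 3 → Fin 3
  col 0F 1F = 0F
  col 1F 0F = 0F
  col 0F 2F = 1F
  col 2F 0F = 1F
  col 1F 2F = 2F
  col 2F 1F = 2F
  col _  _  = 0F

triangleColouring-good : GoodColouring K₄⁻ triangleColouring
triangleColouring-good = star , no-rainbow-small triangleColouring (s≤s (s≤s (s≤s (s≤s z≤n))))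
  where
  single-edge : ∀ {k} (x y : Fin 3) → x ≢ y → colour triangleColouring x y ≡ k →
    (∀ i j → i ≢ j → colour triangleColouring i j ≡ k → SameEdge i j x y) → IsStar (colourClass triangleColouring k)
  single-edge x y x≢y e only = isStar triangleColouring x (λ _ → y) (s≤s (z≤n {0})) (λ _ → x≢y) (λ { {0F} {0F} _ → refl })
    (λ _ → e) λ i j i≢j f → Sum.map (λ (p , q) → p , 0F , sym q) (λ (p , q) → q , 0F , sym p) (only i j i≢j f)
  star : IsStarColouring triangleColouring
  star 0F = single-edge 0F 1F (λ ()) refl λ
    { 0F 1F _ _ → inj₁ (refl , refl) ; 1F 0F _ _ → inj₂ (refl , refl)
    ; 0F 0F ne _ → contradiction refl ne ; 1F 1F ne _ → contradiction refl ne ; 2F 2F ne _ → contradiction refl ne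
    ; 0F 2F _ () ; 2F 0F _ () ; 1F 2F _ () ; 2F 1F _ () }
  star 1F = single-edge 0F 2F (λ ()) refl λ
    { 0F 2F _ _ → inj₁ (refl , refl) ; 2F 0F _ _ → inj₂ (refl , refl)
    ; 0F 0F ne _ → contradiction refl ne ; 1F 1F ne _ → contradiction refl ne ; 2F 2F ne _ → contradiction refl ne
    ; 0F 1F _ () ; 1F 0F _ () ; 1F 2F _ () ; 2F 1F _ () }
  star 2F = single-edge 1F 2F (λ ()) refl λ
    { 1F 2F _ _ → inj₁ (refl , refl) ; 2F 1F _ _ → inj₂ (refl , refl)
    ; 0F 0F ne _ → contradiction refl ne ; 1F 1F ne _ → contradiction refl ne ; 2F 2F ne _ → contradiction refl ne
    ; 0F 1F _ () ; 1F 0F _ () ; 0F 2F _ () ; 2F 0F _ () }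

module AddPair {n s : ℕ} (c : Colouring (suc n) s) where

  -- This reverses the peeling of a uniform pair and gains three colours on two vertices.
  addPair : Colouring (3 + n) (3 + s)
  addPair = record { colour = col ; colour-sym = col-sym ; all-used = used }
    where
    col : Fin (3 + n) → Fin (3 + n) → Fin (3 + s)
    col 0F 0F = 0F
    col 0F 1F = 0F
    col 1F 0F = 0F
    col 1F 1F = 0F
    col 0F (suc (suc _)) = 1F
    col (suc (suc _)) 0F = 1F
    col 1F (suc (suc _)) = 2F
    col (suc (suc _)) 1F = 2F
    col (suc (suc i)) (suc (suc j)) = suc (suc (suc (colour c i j)))
    col-sym : ∀ i j → col i j ≡ col j i
    col-sym 0F 0F = refl
    col-sym 0F 1F = refl
    col-sym 1F 0F = refl
    col-sym 1F 1F = refl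
    col-sym 0F (suc (suc _)) = refl
    col-sym (suc (suc _)) 0F = refl
    col-sym 1F (suc (suc _)) = refl
    col-sym (suc (suc _)) 1F = refl
    col-sym (suc (suc i)) (suc (suc j)) = cong (λ k → suc (suc (suc k))) (colour-sym c i j)
    used : ∀ k → ∃₂ λ i j → i ≢ j × col i j ≡ k
    used 0F = 0F , 1F , (λ ()) , refl
    used 1F = 0F , 2F , (λ ()) , refl
    used 2F = 1F , 2F , (λ ()) , refl
    used (suc (suc (suc k))) = let i , j , i≢j , e = all-used c k in
      suc (suc i) , suc (suc j) , i≢j ∘ suc-injective ∘ suc-injective , cong (λ k → suc (suc (suc k))) e

  raise : Fin (suc n) → Fin (3 + n)
  raise i = suc (suc i)

  raise-injective : Injective _≡_ _≡_ raise
  raise-injective e = suc-injective (suc-injective e)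

  addPair-star : IsStarColouring c → IsStarColouring addPair
  addPair-star star 0F = isStar addPair 0F (λ _ → 1F) (s≤s (z≤n {0})) (λ _ ()) (λ { {0F} {0F} _ → refl }) (λ _ → refl) λ
    { 0F 0F ne _ → contradiction refl ne ; 1F 1F ne _ → contradiction refl ne
    ; 0F 1F _ _ → inj₁ (refl , 0F , refl) ; 1F 0F _ _ → inj₂ (refl , 0F , refl)
    ; 0F (suc (suc _)) _ () ; 1F (suc (suc _)) _ () ; (suc (suc _)) 0F _ () ; (suc (suc _)) 1F _ ()
    ; (suc (suc _)) (suc (suc _)) _ () }
  addPair-star star 1F = isStar addPair 0F raise (s≤s z≤n) (λ _ ()) raise-injective (λ _ → refl) λ
    { 0F 0F _ () ; 1F 1F _ () ; 0F 1F _ () ; 1F 0F _ ()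
    ; 0F (suc (suc j)) _ _ → inj₁ (refl , j , refl) ; 1F (suc (suc _)) _ ()
    ; (suc (suc i)) 0F _ _ → inj₂ (refl , i , refl) ; (suc (suc _)) 1F _ ()
    ; (suc (suc _)) (suc (suc _)) _ () }
  addPair-star star 2F = isStar addPair 1F raise (s≤s z≤n) (λ _ ()) raise-injective (λ _ → refl) λ
    { 0F 0F _ () ; 1F 1F _ () ; 0F 1F _ () ; 1F 0F _ ()
    ; 1F (suc (suc j)) _ _ → inj₁ (refl , j , refl) ; 0F (suc (suc _)) _ ()
    ; (suc (suc i)) 1F _ _ → inj₂ (refl , i , refl) ; (suc (suc _)) 0F _ ()
    ; (suc (suc _)) (suc (suc _)) _ () }
  addPair-star star (suc (suc (suc k))) with star k
  ... | m , 1≤m , f , inj , edges = m , 1≤m , raise ∘ f , (λ e → inj (raise-injective e)) , λ i j → mk⇔ (to i j) from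
    where
    to : ∀ i j → Adj (colourClass addPair (suc (suc (suc k)))) i j →
      ∃₂ λ u w → Adj (K₁, m) u w × raise (f u) ≡ i × raise (f w) ≡ j
    to 0F 0F (_ , ())
    to 0F 1F (_ , ())
    to 1F 0F (_ , ())
    to 1F 1F (_ , ())
    to 0F (suc (suc _)) (_ , ())
    to 1F (suc (suc _)) (_ , ())
    to (suc (suc _)) 0F (_ , ())
    to (suc (suc _)) 1F (_ , ())
    to (suc (suc i)) (suc (suc j)) (i≢j , e)
      with u , w , a , p , q ← Equivalence.to (edges i j)
             (i≢j ∘ cong raise , suc-injective (suc-injective (suc-injective e)))
      = u , w , a , cong raise p , cong raise q
    from : ∀ {i j} → (∃₂ λ u w → Adj (K₁, m) u w × raise (f u) ≡ i × raise (f w) ≡ j) →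
      Adj (colourClass addPair (suc (suc (suc k)))) i j
    from (u , w , a , refl , refl) = let ne , e = Equivalence.from (edges (f u) (f w)) (u , w , a , refl , refl) in
      ne ∘ raise-injective , cong (λ k → suc (suc (suc k))) e

  Raised : Fin (3 + n) → Set
  Raised x = ∃ λ i → x ≡ raise i

  raised? : ∀ x → Dec (Raised x)
  raised? 0F            = no λ ()
  raised? 1F            = no λ ()
  raised? (suc (suc i)) = yes (i , refl)

  two-unraised : ∀ {x y z} → ¬ Raised x → ¬ Raised y → x ≢ y → x ≢ z → y ≢ z → Raised z
  two-unraised {0F} {0F} _ _ xy _ _ = contradiction refl xy
  two-unraised {1F} {1F} _ _ xy _ _ = contradiction refl xy
  two-unraised {suc (suc i)} rx _ _ _ _ = contradiction (i , refl) rx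
  two-unraised {_} {suc (suc i)} _ ry _ _ _ = contradiction (i , refl) ry
  two-unraised {0F} {1F} {0F} _ _ _ xz _ = contradiction refl xz
  two-unraised {0F} {1F} {1F} _ _ _ _ yz = contradiction refl yz
  two-unraised {1F} {0F} {0F} _ _ _ _ yz = contradiction refl yz
  two-unraised {1F} {0F} {1F} _ _ _ xz _ = contradiction refl xz
  two-unraised {z = suc (suc i)} _ _ _ _ _ = i , refl

  unraised-uniform : ∀ {x y z} → ¬ Raised x → Raised y → Raised z → colour addPair x y ≡ colour addPair x z
  unraised-uniform {0F} _ (_ , refl) (_ , refl) = refl
  unraised-uniform {1F} _ (_ , refl) (_ , refl) = refl
  unraised-uniform {suc (suc i)} rx _ _ = contradiction (i , refl) rx

  -- A new vertex repeats its colour towards old ones, so in a rainbow copy it has at most one old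
  -- neighbour. With only two new vertices, the vertices 0 and 1 of degree three must be old, then
  -- so are their common neighbours 2 and 3, and the copy lies in `c`.
  addPair-no-rainbow : ¬ HasRainbow K₄⁻ c → ¬ HasRainbow K₄⁻ addPair
  addPair-no-rainbow ¬rb (f , inj , rb) = ¬rb (g , g-inj , λ u w x y uw xy e →
    rb u w x y uw xy (trans (cong₂ (colour addPair) (f≡ u) (f≡ w))
      (trans (cong (λ k → suc (suc (suc k))) e) (sym (cong₂ (colour addPair) (f≡ x) (f≡ y))))))
    where
    fan₂ : ∀ {u w y} → Adj K₄⁻ u w → Adj K₄⁻ u y → w ≢ y → Raised (f w) → Raised (f y) → Raised (f u)
    fan₂ {u} {w} {y} uw uy w≢y rw ry with raised? (f u)
    ... | yes r = r
    ... | no ¬r with rb u w u y uw uy (unraised-uniform ¬r rw ry)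
    ...   | inj₁ (_ , w≡y)   = contradiction w≡y w≢y
    ...   | inj₂ (u≡y , w≡u) = contradiction (trans w≡u u≡y) w≢y
    fan₃ : ∀ {u w x y} → Adj K₄⁻ u w → Adj K₄⁻ u x → Adj K₄⁻ u y → w ≢ x → w ≢ y → x ≢ y → Raised (f u)
    fan₃ {u} {w} {x} {y} uw ux uy w≢x w≢y x≢y with raised? (f u) | raised? (f w) | raised? (f x)
    ... | yes r | _ | _ = r
    ... | no ¬u | no ¬w | _ = fan₂ ux uy x≢y (other x ux w≢x) (other y uy w≢y)
      where
      other : ∀ v → Adj K₄⁻ u v → w ≢ v → Raised (f v)
      other v uv w≢v = two-unraised ¬u ¬w (proj₁ uw ∘ inj) (proj₁ uv ∘ inj) (w≢v ∘ inj)
    ... | no ¬u | yes rw | yes rx = fan₂ uw ux w≢x rw rx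
    ... | no ¬u | yes rw | no ¬x =
      fan₂ uw uy w≢y rw (two-unraised ¬u ¬x (proj₁ ux ∘ inj) (proj₁ uy ∘ inj) (x≢y ∘ inj))
    all-raised : ∀ u → Raised (f u)
    all-raised 0F = fan₃ {0F} {1F} {2F} {3F}
      ((λ ()) , λ { (inj₁ (() , _)) ; (inj₂ (() , _)) }) ((λ ()) , λ { (inj₁ (() , _)) ; (inj₂ (() , _)) })
      ((λ ()) , λ { (inj₁ (() , _)) ; (inj₂ (() , _)) }) (λ ()) (λ ()) (λ ())
    all-raised 1F = fan₃ {1F} {0F} {2F} {3F}
      ((λ ()) , λ { (inj₁ (() , _)) ; (inj₂ (() , _)) }) ((λ ()) , λ { (inj₁ (() , _)) ; (inj₂ (() , _)) })
      ((λ ()) , λ { (inj₁ (() , _)) ; (inj₂ (() , _)) }) (λ ()) (λ ()) (λ ())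
    all-raised 2F = fan₂ {2F} {0F} {1F} ((λ ()) , λ { (inj₁ (_ , ())) ; (inj₂ (() , _)) })
      ((λ ()) , λ { (inj₁ (_ , ())) ; (inj₂ (() , _)) }) (λ ()) (all-raised 0F) (all-raised 1F)
    all-raised 3F = fan₂ {3F} {0F} {1F} ((λ ()) , λ { (inj₁ (_ , ())) ; (inj₂ (_ , ())) })
      ((λ ()) , λ { (inj₁ (_ , ())) ; (inj₂ (_ , ())) }) (λ ()) (all-raised 0F) (all-raised 1F)
    g : Fin 4 → Fin (suc n)
    g = proj₁ ∘ all-raised
    f≡ : ∀ u → f u ≡ raise (g u)
    f≡ = proj₂ ∘ all-raised
    g-inj : Injective _≡_ _≡_ g
    g-inj {u} {w} e = inj (trans (f≡ u) (trans (cong raise e) (sym (f≡ w))))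

-- There is one start for each parity, both with fewer than four vertices and hence without any copy
-- of `K₄⁻`.
extremal-colouring : ∀ n → ∃ λ (c : Colouring (2 + n) (bound (2 + n))) → GoodColouring K₄⁻ c
extremal-colouring 0 = edgeColouring , edgeColouring-good
extremal-colouring 1 = triangleColouring , triangleColouring-good
extremal-colouring (suc (suc n)) =
  let c , star , ¬rb = extremal-colouring n
      open AddPair c
  in addPair , addPair-star star , addPair-no-rainbow ¬rb

theorem1p6 : ∀ (n : ℕ) → 2 ≤ n →
    Isar⋆ n K₄⁻ (3 * (n ∸ 1) / 2) ×
    (∀ (c : Colouring n (3 * (n ∸ 1) / 2)) →
    IsStarColouring c → ¬ HasRainbow K₄⁻ c → HasStructure c)
theorem1p6 (suc (suc n)) (s≤s (s≤s z≤n)) =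
  ( subst (λ s → ∃ λ (c : Colouring (2 + n) s) → GoodColouring K₄⁻ c) (bound-formula (suc n)) (extremal-colouring n)
  , λ s c (star , ¬rb) → subst (s ≤_) (bound-formula (suc n)) (upper-bound c (colouring-local c star ¬rb)) ) ,
  λ c star ¬rb → extremal-structure n c (bound-formula (suc n)) (colouring-local c star ¬rb)
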